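{- Let $k\ge1$. For all $n\ge k+1$, $$N^{k(k-1)\cdots1}_{12\text{ - }3}(n)=(k+1)B_{n-k}+\sum_{j=0}^{n-k-2}\left(\binom{n}{k+j}-k\binom{n-k-1}{j}-\binom{n-k}{j}\right)B_{n-k-1-j},$$ together with $N^{k(k-1)\cdots1}_{12\text{ - }3}(k)=1$ and $N^{k(k-1)\cdots1}_{12\text{ - }3}(n)=0$ for all $1\le n\le k-1$.
   Context: A permutation $\pi=\pi_1\cdots\pi_n$ of $\{1,\dots,n\}$ contains the generalized pattern $12\text{ - }3$ if there are indices $i,j$ with $i+1<j\le n$ such that $\pi_i\pi_{i+1}\pi_j$ is order-isomorphic to $123$; otherwise it avoids it. A permutation $\pi$ begins with a pattern $p=p_1\cdots p_k$ if $n\ge k$ and $\pi_1\cdots\pi_k$ is order-isomorphic to $p$. $N^p_q(n)$ is the number of permutations of $\{1,\dots,n\}$ that avoid $q$ and begin with $p$. $B_m$ is the $m$th Bell number (number of set partitions of an $m$-element set, $B_0=1$). An empty sum is $0$. -}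

module Defs where

open import Data.Bool using (true; false)
open import Data.Bool.Properties using () renaming (_≟_ to _≟ᵇ_)
open import Data.Fin using (Fin; toℕ)
open import Data.Fin.Properties using (all?; any?)
open import Data.Fin.Subset using (Subset; Nonempty; Empty; _∩_; ⋃; ⊤)
open import Data.Fin.Subset.Properties using (nonempty?)
open import Data.Integer using (ℤ; 0ℤ)
import Data.Integer as ℤ
open import Data.List using (List; []; _∷_; _++_; map; foldr; filter; length; upTo; cartesianProductWith)
open import Data.List.Relation.Unary.All using (All) renaming (all? to allᴸ?)
open import Data.List.Relation.Unary.AllPairs using (AllPairs; allPairs?)
open import Data.Nat using (ℕ; zero; suc; _∸_; _<_; _≤_; _≟_; _<?_; _≤?_)
open import Data.Nat.Properties using (≤-irrelevant)
open import Data.Product using (Σ-syntax; ∃-syntax; _×_; _,_; uncurry)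
open import Data.Vec using (Vec; lookup; tabulate; truncate) renaming ([] to []ᵛ; _∷_ to _∷ᵛ_)
open import Data.Vec.Properties using (≡-dec)
open import Data.Vec.Relation.Unary.Unique.Propositional using (Unique)
import Data.Vec.Relation.Unary.AllPairs as VecAllPairs
open import Function.Bundles using (_⇔_; mk⇔; Equivalence)
open import Relation.Binary.PropositionalEquality using (_≡_; subst)
open import Relation.Nullary using (Dec; yes; no; ¬_)
open import Relation.Nullary.Decidable using (¬?; map′; _×-dec_; _→-dec_)
open import Relation.Unary using (Decidable)

-- Lists each word of length n over the given letters, once if the letters are
-- distinct.
words : ∀ {A : Set} → List A → ∀ n → List (Vec A n)
words as zero    = []ᵛ ∷ []
words as (suc n) = cartesianProductWith _∷ᵛ_ as (words as n)

sublists : ∀ {A : Set} → List A → List (List A)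
sublists []       = [] ∷ []
sublists (x ∷ xs) = map (x ∷_) (sublists xs) ++ sublists xs

∑< : ℕ → (ℕ → ℤ) → ℤ
∑< n f = foldr ℤ._+_ 0ℤ (map f (upTo n))

syntax ∑< n (λ i → e) = ∑[ i < n ] e

IsSetPartition : ∀ {m} → List (Subset m) → Set
IsSetPartition blocks =
  All Nonempty blocks
  × AllPairs (λ S T → Empty (S ∩ T)) blocks
  × ⋃ blocks ≡ ⊤

isSetPartition? : ∀ {m} → Decidable (IsSetPartition {m})
isSetPartition? blocks =
  allᴸ? nonempty? blocks
  ×-dec allPairs? (λ S T → ¬? (nonempty? (S ∩ T))) blocks
  ×-dec ≡-dec _≟ᵇ_ (⋃ blocks) ⊤

allSubsets : ∀ m → List (Subset m)
allSubsets = words (true ∷ false ∷ [])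

-- allSubsets m has no repetitions, so its sublists represent each family of
-- subsets of Fin m exactly once.
setPartitions : ∀ m → List (List (Subset m))
setPartitions m = filter isSetPartition? (sublists (allSubsets m))

bell : ℕ → ℕ
bell m = length (setPartitions m)

unique? : ∀ {n} → Decidable (Unique {A = ℕ} {n})
unique? = VecAllPairs.allPairs? λ x y → ¬? (x ≟ y)

-- The permutations π₁⋯πₙ of {1,…,n}: repetition-free words of length n over
-- {1,…,n}.
permutations : ∀ n → List (Vec ℕ n)
permutations n = filter unique? (words (map suc (upTo n)) n)

OrderIsomorphic : ∀ {k} → Vec ℕ k → Vec ℕ k → Set
OrderIsomorphic u v = ∀ i j → (lookup u i < lookup u j) ⇔ (lookup v i < lookup v j)

orderIsomorphic? : ∀ {k} (u v : Vec ℕ k) → Dec (OrderIsomorphic u v)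
orderIsomorphic? u v = all? λ i → all? λ j →
  map′ (uncurry mk⇔) (λ e → Equivalence.to e , Equivalence.from e)
    ((lookup u i <? lookup u j →-dec lookup v i <? lookup v j)
     ×-dec (lookup v i <? lookup v j →-dec lookup u i <? lookup u j))

Contains12-3 : ∀ {n} → Vec ℕ n → Set
Contains12-3 {n} π =
  ∃[ i ] ∃[ i′ ] ∃[ j ]
    toℕ {n} i′ ≡ suc (toℕ {n} i)
    × toℕ i′ < toℕ {n} j
    × OrderIsomorphic (lookup π i ∷ᵛ lookup π i′ ∷ᵛ lookup π j ∷ᵛ []ᵛ) (1 ∷ᵛ 2 ∷ᵛ 3 ∷ᵛ []ᵛ)

Avoids12-3 : ∀ {n} → Vec ℕ n → Set
Avoids12-3 π = ¬ Contains12-3 π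

avoids12-3? : ∀ {n} → Decidable (Avoids12-3 {n})
avoids12-3? π = ¬? (any? λ i → any? λ i′ → any? λ j →
  (toℕ i′ ≟ suc (toℕ i)) ×-dec (toℕ i′ <? toℕ j)
  ×-dec orderIsomorphic?
          (lookup π i ∷ᵛ lookup π i′ ∷ᵛ lookup π j ∷ᵛ []ᵛ) (1 ∷ᵛ 2 ∷ᵛ 3 ∷ᵛ []ᵛ))

BeginsWith : ∀ {k n} → Vec ℕ k → Vec ℕ n → Set
BeginsWith {k} {n} p π = Σ[ k≤n ∈ k ≤ n ] OrderIsomorphic (truncate k≤n π) p

beginsWith? : ∀ {k n} (p : Vec ℕ k) → Decidable (BeginsWith {k} {n} p)
beginsWith? {k} {n} p π with k ≤? n
... | no  k≰n = no λ (k≤n , _) → k≰n k≤n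
... | yes k≤n = map′ (k≤n ,_)
  (λ (k≤n′ , iso) → subst (λ h → OrderIsomorphic (truncate h π) p) (≤-irrelevant k≤n′ k≤n) iso)
  (orderIsomorphic? (truncate k≤n π) p)

N12-3 : ∀ {k} → Vec ℕ k → ℕ → ℕ
N12-3 p n =
  length (filter (λ π → avoids12-3? π ×-dec beginsWith? p π) (permutations n))

decreasing : ∀ k → Vec ℕ k
decreasing k = tabulate λ i → k ∸ toℕ i

{-# OPTIONS --safe #-}

-- An ascent ending in b forces every later letter below b. So if a word with
-- letters still to be placed has just written p, the next letter either
-- descends or is the largest remaining one, and the number of completions
-- depends only on how many remaining letters lie below p. This gives a
-- Bell-triangle recursion ("extensions"), which Pascal's rule solves in terms
-- of its diagonal; the recursion of set partitions by the block of an element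
-- shows that this diagonal consists of the Bell numbers.
module Submission where

open import Defs

module _ where
  open import Data.Bool using (true; false; if_then_else_)
  open import Data.Bool.Properties using () renaming (_≟_ to _≟ᵇ_)
  import Data.Empty as Empty
  open import Data.Fin using (zero; suc; toℕ)
  open import Data.Fin.Subset
    using (Subset; inside; outside; Nonempty; Empty; _∩_; _∪_; _─_; ⋃; ⊤; _∈_; _∉_; _⊆_; ∣_∣)
  open import Data.Fin.Subset.Properties
  open import Data.Integer as ℤ using (ℤ; 0ℤ; 1ℤ)
  import Data.Integer.Properties as ℤ
  import Data.Integer.Tactic.RingSolver as ℤSolver
  open import Data.List
    using (List; []; _∷_; _++_; map; filter; foldr; length; upTo; cartesianProductWith)
  open import Data.List.Membership.Propositional using () renaming (_∈_ to _∈ᴸ_)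
  open import Data.List.Membership.Propositional.Properties using (∈-filter⁺)
  open import Data.List.Properties
    using (upTo-∷ʳ; map-upTo; map-cong; ++-identityʳ; filter-all; filter-notAll; filter-accept;
           filter-reject; length-map; length-upTo)
  open import Data.List.Relation.Unary.All as All using (All; []; _∷_)
  import Data.List.Relation.Unary.All.Properties as All
  open import Data.List.Relation.Unary.AllPairs as AllPairs using (AllPairs; []; _∷_; allPairs?)
  import Data.List.Relation.Unary.AllPairs.Properties as AllPairs
  open import Data.List.Relation.Unary.Any as Any using (here; there)
  open import Data.Nat
  open import Data.Nat.Combinatorics
    using (_C_; k>n⇒nCk≡0; nCk+nC[k+1]≡[n+1]C[k+1]; nCk≡nC[n∸k]; nCn≡1; nC1≡n)
  open import Data.Nat.Properties
  open import Data.Nat.Tactic.RingSolver using (solve-∀)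
  open import Data.Product using (_×_; _,_; proj₁; proj₂)
  open import Data.Sum using (inj₁; inj₂)
  import Data.Unit as Unit
  open import Data.Vec as Vec using (Vec; lookup; truncate) renaming ([] to []ᵛ; _∷_ to _∷ᵛ_)
  open import Data.Vec.Properties using (≡-dec; ∷-injectiveʳ; lookup∘tabulate)
  import Data.Vec.Relation.Unary.All as VecAll
  open import Data.Vec.Relation.Unary.All.Properties using (lookup⁺; lookup⁻)
  open import Function using (_∘_; id; _⇔_; mk⇔; Equivalence)
  open import Relation.Binary using (tri<; tri≈; tri>)
  open import Relation.Binary.PropositionalEquality
  open import Relation.Nullary using (Dec; yes; no; does; ¬_; contradiction)
  open import Relation.Nullary.Decidable using (_×-dec_; _→-dec_; dec-true; dec-false; ¬?)
  open import Relation.Unary using (Decidable)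
  open ≡-Reasoning

  -- Put d = n - k - 1. Telescoping the recursion over the prefix length gives the count as B_{d+1}
  -- + Σ_{m=0}^{d} (C(n,m+1) - C(d+1,m+1)) B_m. The stated sum is this one read backwards, with j =
  -- d - m, and without its term m = 0. That term is n - (d+1) = k, and the Bell recurrence B_{d+1}
  -- = 1 + Σ_{j<d} C(d,j) B_{d-j} turns it into k B_{d+1} - k Σ_{j<d} C(d,j) B_{d-j}: hence the
  -- factor k + 1 and the subtracted multiple of k. The prefix condition fits a recursion on the
  -- next letter because a virtual letter n + 1 is placed in front: it starts no ascent, and a
  -- decreasing prefix of length k becomes k forced descents.

  private variable
    A B D : Set
    P Q : Set

  -- Indicators and finite sums of natural numbers

  +-swap : ∀ a b c → a + (b + c) ≡ b + (a + c)
  +-swap = solve-∀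

  *-swap : ∀ a b c → a * (b * c) ≡ b * (a * c)
  *-swap = solve-∀

  𝟙 : Dec P → ℕ
  𝟙 d = if does d then 1 else 0

  𝟙-yes : (d : Dec P) → P → 𝟙 d ≡ 1
  𝟙-yes d p rewrite dec-true d p = refl

  𝟙-no : (d : Dec P) → ¬ P → 𝟙 d ≡ 0
  𝟙-no d ¬p rewrite dec-false d ¬p = refl

  𝟙-cong : (P → Q) → (Q → P) → (d : Dec P) (e : Dec Q) → 𝟙 d ≡ 𝟙 e
  𝟙-cong f g (yes p) e = sym (𝟙-yes e (f p))
  𝟙-cong f g (no ¬p) e = sym (𝟙-no e (¬p ∘ g))

  𝟙-× : (d : Dec P) (e : Dec Q) → 𝟙 (d ×-dec e) ≡ 𝟙 d * 𝟙 e
  𝟙-× (yes _) e = sym (+-identityʳ _)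
  𝟙-× (no _) e = refl

  ∑ : List A → (A → ℕ) → ℕ
  ∑ [] f = 0
  ∑ (x ∷ xs) f = f x + ∑ xs f

  ∑-cong-local : ∀ {xs : List A} {f g} → All (λ x → f x ≡ g x) xs → ∑ xs f ≡ ∑ xs g
  ∑-cong-local [] = refl
  ∑-cong-local (e ∷ es) = cong₂ _+_ e (∑-cong-local es)

  ∑-cong : ∀ (xs : List A) {f g} → (∀ x → f x ≡ g x) → ∑ xs f ≡ ∑ xs g
  ∑-cong [] e = refl
  ∑-cong (x ∷ xs) e = cong₂ _+_ (e x) (∑-cong xs e)

  ∑-zero : ∀ (xs : List A) {f} → (∀ x → f x ≡ 0) → ∑ xs f ≡ 0
  ∑-zero [] e = refl
  ∑-zero (x ∷ xs) e = cong₂ _+_ (e x) (∑-zero xs e)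

  ∑-++ : ∀ (xs ys : List A) f → ∑ (xs ++ ys) f ≡ ∑ xs f + ∑ ys f
  ∑-++ [] ys f = refl
  ∑-++ (x ∷ xs) ys f = trans (cong (f x +_) (∑-++ xs ys f)) (sym (+-assoc (f x) _ _))

  ∑-map : ∀ (h : A → B) xs f → ∑ (map h xs) f ≡ ∑ xs (f ∘ h)
  ∑-map h [] f = refl
  ∑-map h (x ∷ xs) f = cong (f (h x) +_) (∑-map h xs f)

  ∑-cartesianProductWith : ∀ (h : A → B → D) xs ys f →
    ∑ (cartesianProductWith h xs ys) f ≡ ∑ xs λ x → ∑ ys λ y → f (h x y)
  ∑-cartesianProductWith h [] ys f = refl
  ∑-cartesianProductWith h (x ∷ xs) ys f =
    trans (∑-++ (map (h x) ys) _ f)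
          (cong₂ _+_ (∑-map (h x) ys f) (∑-cartesianProductWith h xs ys f))

  ∑-+ : ∀ (xs : List A) f g → ∑ xs (λ x → f x + g x) ≡ ∑ xs f + ∑ xs g
  ∑-+ [] f g = refl
  ∑-+ (x ∷ xs) f g = trans (cong (f x + g x +_) (∑-+ xs f g)) (lemma (f x) (g x) _ _)
    where
    lemma : ∀ a b c d → a + b + (c + d) ≡ a + c + (b + d)
    lemma = solve-∀

  ∑-*ˡ : ∀ c (xs : List A) f → ∑ xs (λ x → c * f x) ≡ c * ∑ xs f
  ∑-*ˡ c [] f = sym (*-zeroʳ c)
  ∑-*ˡ c (x ∷ xs) f = trans (cong (c * f x +_) (∑-*ˡ c xs f)) (sym (*-distribˡ-+ c (f x) _))

  ∑-filter : ∀ {P : A → Set} (P? : Decidable P) xs f →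
    ∑ (filter P? xs) f ≡ ∑ xs λ x → 𝟙 (P? x) * f x
  ∑-filter P? [] f = refl
  ∑-filter P? (x ∷ xs) f with does (P? x)
  ... | true  = cong₂ _+_ (sym (+-identityʳ (f x))) (∑-filter P? xs f)
  ... | false = ∑-filter P? xs f

  length-filter : ∀ {P : A → Set} (P? : Decidable P) xs →
    length (filter P? xs) ≡ ∑ xs (𝟙 ∘ P?)
  length-filter P? [] = refl
  length-filter P? (x ∷ xs) with does (P? x)
  ... | true  = cong suc (length-filter P? xs)
  ... | false = length-filter P? xs

  ∑-upTo-sucˡ : ∀ n f → ∑ (upTo (suc n)) f ≡ f 0 + ∑ (upTo n) (f ∘ suc)
  ∑-upTo-sucˡ n f = cong (f 0 +_)
    (trans (cong (λ xs → ∑ xs f) (sym (map-upTo suc n))) (∑-map suc (upTo n) f))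

  ∑-upTo-sucʳ : ∀ n f → ∑ (upTo (suc n)) f ≡ ∑ (upTo n) f + f n
  ∑-upTo-sucʳ n f = begin
    ∑ (upTo (suc n)) f          ≡⟨ cong (λ xs → ∑ xs f) (upTo-∷ʳ n) ⟨
    ∑ (upTo n ++ n ∷ []) f      ≡⟨ ∑-++ (upTo n) _ f ⟩
    ∑ (upTo n) f + (f n + 0)    ≡⟨ cong (∑ (upTo n) f +_) (+-identityʳ _) ⟩
    ∑ (upTo n) f + f n          ∎

  ∑-upTo-reverse : ∀ d f → ∑ (upTo (suc d)) (λ j → f (d ∸ j)) ≡ ∑ (upTo (suc d)) f
  ∑-upTo-reverse zero f = refl
  ∑-upTo-reverse (suc d) f = begin
    ∑ (upTo (2 + d)) (λ j → f (suc d ∸ j))         ≡⟨ ∑-upTo-sucˡ (suc d) (λ j → f (suc d ∸ j)) ⟩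
    f (suc d) + ∑ (upTo (suc d)) (λ j → f (d ∸ j)) ≡⟨ cong (f (suc d) +_) (∑-upTo-reverse d f) ⟩
    f (suc d) + ∑ (upTo (suc d)) f                 ≡⟨ +-comm (f (suc d)) _ ⟩
    ∑ (upTo (suc d)) f + f (suc d)                 ≡⟨ ∑-upTo-sucʳ (suc d) f ⟨
    ∑ (upTo (2 + d)) f                             ∎

  -- The Bell-triangle recursion and its solution by binomial sums

  -- extensions t k l counts the arrangements w of t letters, l of them below a
  -- given letter p, such that p w avoids 12-3 and descends for its first k steps.
  -- A first letter above p is possible only for k = 0 and if it is the largest.
  extensions : ℕ → ℕ → ℕ → ℕ
  extensions zero    zero    l = 1
  extensions zero    (suc k) l = 0
  extensions (suc t) zero    l =
    ∑ (upTo l) (extensions t zero) + 𝟙 (l <? suc t) * extensions t zero t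
  extensions (suc t) (suc k) l = ∑ (upTo l) (extensions t k)

  -- A letter above all `n` others begins no ascent, and no descent is forced, so this counts all
  -- 12-3-avoiding arrangements of `n` letters. The name is justified by `bell≡bellNumber`.
  bellNumber : ℕ → ℕ
  bellNumber n = extensions n 0 n

  -- Raising `p` past one letter adds exactly one descent, to the letter of rank `l`. The bound
  -- `l < t` keeps some letter above `p` in both counts, so the ascent to the maximum contributes
  -- equally.
  extensions-pascal₀ : ∀ {t l} → l < t →
    extensions (suc t) 0 (suc l) ≡ extensions (suc t) 0 l + extensions t 0 l
  extensions-pascal₀ {t} {l} l<t
    rewrite 𝟙-yes (suc l <? suc t) (s<s l<t) | 𝟙-yes (l <? suc t) (m<n⇒m<1+n l<t)
          | ∑-upTo-sucʳ l (extensions t 0)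
    = lemma (∑ (upTo l) (extensions t 0)) (extensions t 0 l) (extensions t 0 t)
    where
    lemma : ∀ a b c → a + b + (c + 0) ≡ a + (c + 0) + b
    lemma = solve-∀

  extensions-pascal₁ : ∀ t k l →
    extensions (suc t) (suc k) (suc l) ≡ extensions (suc t) (suc k) l + extensions t k l
  extensions-pascal₁ t k l = ∑-upTo-sucʳ l (extensions t k)

  -- Nothing lies below `p`, so the next letter is the maximum, and then all `h` others lie below
  -- it.
  extensions-none : ∀ h → extensions (suc h) 0 0 ≡ bellNumber h
  extensions-none h rewrite 𝟙-yes (0 <? suc h) z<s = +-identityʳ _

  -- When `p` passes the maximum, the ascent to that letter becomes a descent to it; either way the
  -- other `t` letters lie below the letter just written.
  extensions-top : ∀ t → extensions (suc t) 0 (suc t) ≡ extensions (suc t) 0 t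
  extensions-top t
    rewrite 𝟙-no (suc t <? suc t) (<-irrefl refl) | 𝟙-yes (t <? suc t) ≤-refl
          | ∑-upTo-sucʳ t (extensions t 0)
    = lemma (∑ (upTo t) (extensions t 0)) (extensions t 0 t)
    where
    lemma : ∀ a b → a + b + 0 ≡ a + (b + 0)
    lemma = solve-∀

  extensions-below : ∀ t k l → l < k → extensions t k l ≡ 0
  extensions-below zero    (suc k) l _ = refl
  extensions-below (suc t) (suc k) zero _ = refl
  extensions-below (suc t) (suc k) (suc l) (s<s l<k) = begin
    extensions (suc t) (suc k) (suc l)                  ≡⟨ extensions-pascal₁ t k l ⟩
    extensions (suc t) (suc k) l + extensions t k l     ≡⟨ cong₂ _+_ (extensions-below (suc t) (suc k) l (m<n⇒m<1+n l<k)) (extensions-below t k l l<k) ⟩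
    0                                                   ∎

  extensions-all : ∀ k → extensions k k k ≡ 1
  extensions-all zero = refl
  extensions-all (suc k) = begin
    extensions (suc k) (suc k) (suc k)              ≡⟨ extensions-pascal₁ k k k ⟩
    extensions (suc k) (suc k) k + extensions k k k ≡⟨ cong₂ _+_ (extensions-below (suc k) (suc k) k ≤-refl) (extensions-all k) ⟩
    1                                               ∎

  -- A binomial transform of the Bell numbers, cut off at m = `d` and shifted by `h`. In
  -- `extensions-binomialSum`, `n` letters lie below `p`, `h` + 1 lie above it, and `n` - `d` is the
  -- number of forced descents.
  binomialSum : ℕ → ℕ → ℕ → ℕ
  binomialSum n d h = ∑ (upTo (suc d)) λ m → (n C m) * bellNumber (m + h)

  nC0≡1 : ∀ n → n C 0 ≡ 1
  nC0≡1 n = trans (nCk≡nC[n∸k] {0} {n} z≤n) (nCn≡1 n)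

  binomialSum-zero : ∀ n h → binomialSum n 0 h ≡ bellNumber h
  binomialSum-zero n h rewrite nC0≡1 n = trans (+-identityʳ _) (+-identityʳ _)

  -- Pascal's rule splits C(n+1,m+1). The C(n,m) parts lose one term at the cut and move the shift
  -- to `suc h`; the C(n,m+1) parts, with the old term m = 0, form the other sum.
  binomialSum-pascal : ∀ n d h →
    binomialSum (suc n) (suc d) h ≡ binomialSum n d (suc h) + binomialSum n (suc d) h
  binomialSum-pascal n d h = begin
    binomialSum (suc n) (suc d) h
      ≡⟨ ∑-upTo-sucˡ (suc d) (λ m → (suc n C m) * bellNumber (m + h)) ⟩
    (suc n C 0) * bellNumber h + ∑ (upTo (suc d)) (λ m → (suc n C suc m) * bellNumber (suc m + h))
      ≡⟨ cong₂ _+_ (cong (_* bellNumber h) (trans (nC0≡1 (suc n)) (sym (nC0≡1 n))))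
                   (∑-cong (upTo (suc d)) split) ⟩
    c + ∑ (upTo (suc d)) (λ m → f m + g m)
      ≡⟨ cong (c +_) (∑-+ (upTo (suc d)) f g) ⟩
    c + (binomialSum n d (suc h) + ∑ (upTo (suc d)) g)
      ≡⟨ +-swap c (binomialSum n d (suc h)) _ ⟩
    binomialSum n d (suc h) + (c + ∑ (upTo (suc d)) g)
      ≡⟨ cong (binomialSum n d (suc h) +_) (∑-upTo-sucˡ (suc d) (λ m → (n C m) * bellNumber (m + h))) ⟨
    binomialSum n d (suc h) + binomialSum n (suc d) h ∎
    where
    c = (n C 0) * bellNumber h
    f g : ℕ → ℕ
    f m = (n C m) * bellNumber (m + suc h)
    g m = (n C suc m) * bellNumber (suc m + h)
    split : ∀ m → (suc n C suc m) * bellNumber (suc m + h) ≡ f m + g m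
    split m = begin
      (suc n C suc m) * bellNumber (suc m + h)
        ≡⟨ cong (_* bellNumber (suc m + h)) (nCk+nC[k+1]≡[n+1]C[k+1] n m) ⟨
      (n C m + n C suc m) * bellNumber (suc m + h)
        ≡⟨ *-distribʳ-+ (bellNumber (suc m + h)) (n C m) _ ⟩
      (n C m) * bellNumber (suc m + h) + g m
        ≡⟨ cong (λ i → (n C m) * bellNumber i + g m) (+-suc m h) ⟨
      f m + g m ∎

  binomialSum-saturated : ∀ d h → binomialSum d (suc d) h ≡ binomialSum d d h
  binomialSum-saturated d h
    rewrite ∑-upTo-sucʳ (suc d) (λ m → (d C m) * bellNumber (m + h))
          | k>n⇒nCk≡0 (n<1+n d) = +-identityʳ _

  -- Both sides obey the same Pascal recursion: (`suc k`, `suc d`, `h`) is the sum of (`suc k`, `d`,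
  -- `suc h`) and (`k`, `suc d`, `h`). The length `suc (k + d + h)` encodes that at least `k`
  -- letters lie below `p` and at least one above, as `extensions-pascal₀` requires. For `k` = 0 the
  -- second sum is one term short of the cut, and `binomialSum-saturated` supplies a vanishing term.
  extensions-binomialSum : ∀ k d h →
    extensions (suc (k + d + h)) k (k + d) ≡ binomialSum (k + d) d h
  extensions-binomialSum zero zero h =
    trans (extensions-none h) (sym (binomialSum-zero 0 h))
  extensions-binomialSum zero (suc d) h = begin
    extensions (2 + (d + h)) 0 (suc d)
      ≡⟨ extensions-pascal₀ (s≤s (m≤m+n d h)) ⟩
    extensions (2 + (d + h)) 0 d + extensions (suc (d + h)) 0 d
      ≡⟨ cong (λ t → extensions (suc t) 0 d + extensions (suc (d + h)) 0 d) (+-suc d h) ⟨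
    extensions (suc (d + suc h)) 0 d + extensions (suc (d + h)) 0 d
      ≡⟨ cong₂ _+_ (extensions-binomialSum zero d (suc h)) (extensions-binomialSum zero d h) ⟩
    binomialSum d d (suc h) + binomialSum d d h
      ≡⟨ cong (binomialSum d d (suc h) +_) (binomialSum-saturated d h) ⟨
    binomialSum d d (suc h) + binomialSum d (suc d) h
      ≡⟨ binomialSum-pascal d d h ⟨
    binomialSum (suc d) (suc d) h ∎
  extensions-binomialSum (suc k) zero h rewrite +-identityʳ k = begin
    extensions (2 + (k + h)) (suc k) (suc k)
      ≡⟨ extensions-pascal₁ (suc (k + h)) k k ⟩
    extensions (2 + (k + h)) (suc k) k + extensions (suc (k + h)) k k
      ≡⟨ cong (_+ extensions (suc (k + h)) k k) (extensions-below (2 + (k + h)) (suc k) k ≤-refl) ⟩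
    extensions (suc (k + h)) k k
      ≡⟨ cong (λ i → extensions (suc (i + h)) k i) (+-identityʳ k) ⟨
    extensions (suc (k + 0 + h)) k (k + 0)
      ≡⟨ extensions-binomialSum k zero h ⟩
    binomialSum (k + 0) 0 h
      ≡⟨ binomialSum-zero (k + 0) h ⟩
    bellNumber h
      ≡⟨ binomialSum-zero (suc k) h ⟨
    binomialSum (suc k) 0 h ∎
  extensions-binomialSum (suc k) (suc d) h = begin
    extensions (2 + t) (suc k) (suc (k + suc d))
      ≡⟨ extensions-pascal₁ (suc t) k (k + suc d) ⟩
    extensions (2 + t) (suc k) (k + suc d) + extensions (suc t) k (k + suc d)
      ≡⟨ cong₂ _+_ (cong₂ (λ s l → extensions s (suc k) l) (cong (2 +_) shift) (+-suc k d))
                   (extensions-binomialSum k (suc d) h) ⟩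
    extensions (2 + (k + d + suc h)) (suc k) (suc k + d) + binomialSum (k + suc d) (suc d) h
      ≡⟨ cong (_+ binomialSum (k + suc d) (suc d) h) (extensions-binomialSum (suc k) d (suc h)) ⟩
    binomialSum (suc k + d) d (suc h) + binomialSum (k + suc d) (suc d) h
      ≡⟨ cong (λ i → binomialSum i d (suc h) + binomialSum (k + suc d) (suc d) h) (+-suc k d) ⟨
    binomialSum (k + suc d) d (suc h) + binomialSum (k + suc d) (suc d) h
      ≡⟨ binomialSum-pascal (k + suc d) d h ⟨
    binomialSum (suc (k + suc d)) (suc d) h ∎
    where
    t = k + suc d + h
    shift : k + suc d + h ≡ k + d + suc h
    shift = trans (cong (_+ h) (+-suc k d)) (sym (+-suc (k + d) h))

  -- The Bell recurrence. The closed form needs a letter above `p`, which the diagonal lacks;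
  -- `extensions-top` trades the diagonal value for the one just before it.
  bellNumber-suc : ∀ d → bellNumber (suc d) ≡ binomialSum d d 0
  bellNumber-suc d = begin
    extensions (suc d) 0 (suc d)   ≡⟨ extensions-top d ⟩
    extensions (suc d) 0 d         ≡⟨ cong (λ t → extensions (suc t) 0 d) (+-identityʳ d) ⟨
    extensions (suc (d + 0)) 0 d   ≡⟨ extensions-binomialSum 0 d 0 ⟩
    binomialSum d d 0              ∎

  -- One sum is on the left so that no subtraction occurs.
  extensions-closed : ∀ k d →
    extensions (k + suc d) k (k + suc d) + ∑ (upTo (suc d)) (λ m → (suc d C suc m) * bellNumber m)
    ≡ bellNumber (suc d) + ∑ (upTo (suc d)) (λ m → ((k + suc d) C suc m) * bellNumber m)
  extensions-closed zero d = refl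
  extensions-closed (suc k) d = begin
    extensions (suc n) (suc k) (suc n) + s
      -- The words starting with the maximum are the case `k` again; the other first letters form a
      -- binomial sum, which Pascal's rule merges into the sum already obtained.
      ≡⟨ cong (_+ s) (extensions-pascal₁ n k n) ⟩
    extensions (suc n) (suc k) n + extensions n k n + s
      ≡⟨ +-assoc (extensions (suc n) (suc k) n) _ s ⟩
    extensions (suc n) (suc k) n + (extensions n k n + s)
      ≡⟨ cong₂ _+_ head (extensions-closed k d) ⟩
    binomialSum n d 0 + (bellNumber (suc d) + ∑ (upTo (suc d)) g)
      ≡⟨ +-swap (binomialSum n d 0) (bellNumber (suc d)) _ ⟩
    bellNumber (suc d) + (binomialSum n d 0 + ∑ (upTo (suc d)) g)
      ≡⟨ cong (bellNumber (suc d) +_) (∑-+ (upTo (suc d)) (λ m → (n C m) * bellNumber (m + 0)) g) ⟨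
    bellNumber (suc d) + ∑ (upTo (suc d)) (λ m → (n C m) * bellNumber (m + 0) + g m)
      ≡⟨ cong (bellNumber (suc d) +_) (∑-cong (upTo (suc d)) merge) ⟩
    bellNumber (suc d) + ∑ (upTo (suc d)) (λ m → (suc n C suc m) * bellNumber m) ∎
    where
    n = k + suc d
    s = ∑ (upTo (suc d)) (λ m → (suc d C suc m) * bellNumber m)
    g : ℕ → ℕ
    g m = (n C suc m) * bellNumber m
    head : extensions (suc n) (suc k) n ≡ binomialSum n d 0
    head rewrite +-suc k d = trans
      (cong (λ t → extensions (2 + t) (suc k) (suc k + d)) (sym (+-identityʳ (k + d))))
      (extensions-binomialSum (suc k) d 0)
    merge : ∀ m → (n C m) * bellNumber (m + 0) + g m ≡ (suc n C suc m) * bellNumber m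
    merge m = begin
      (n C m) * bellNumber (m + 0) + g m      ≡⟨ cong (λ i → (n C m) * bellNumber i + g m) (+-identityʳ m) ⟩
      (n C m) * bellNumber m + g m            ≡⟨ *-distribʳ-+ (bellNumber m) (n C m) _ ⟨
      (n C m + n C suc m) * bellNumber m      ≡⟨ cong (_* bellNumber m) (nCk+nC[k+1]≡[n+1]C[k+1] n m) ⟩
      (suc n C suc m) * bellNumber m          ∎

  -- Set partitions, counted by the block of an element

  ∑-sublists-++ : ∀ (xs ys : List A) f →
    ∑ (sublists (xs ++ ys)) f ≡ ∑ (sublists xs) λ us → ∑ (sublists ys) λ vs → f (us ++ vs)
  ∑-sublists-++ [] ys f = sym (+-identityʳ _)
  ∑-sublists-++ (x ∷ xs) ys f = begin
    ∑ (map (x ∷_) (sublists (xs ++ ys)) ++ sublists (xs ++ ys)) f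
      ≡⟨ ∑-++ (map (x ∷_) (sublists (xs ++ ys))) _ f ⟩
    ∑ (map (x ∷_) (sublists (xs ++ ys))) f + ∑ (sublists (xs ++ ys)) f
      ≡⟨ cong₂ _+_ (trans (∑-map (x ∷_) (sublists (xs ++ ys)) f) (∑-sublists-++ xs ys (f ∘ (x ∷_))))
                   (∑-sublists-++ xs ys f) ⟩
    ∑ (sublists xs) (g ∘ (x ∷_)) + ∑ (sublists xs) g
      ≡⟨ cong (_+ ∑ (sublists xs) g) (∑-map (x ∷_) (sublists xs) g) ⟨
    ∑ (map (x ∷_) (sublists xs)) g + ∑ (sublists xs) g
      ≡⟨ ∑-++ (map (x ∷_) (sublists xs)) _ g ⟨
    ∑ (map (x ∷_) (sublists xs) ++ sublists xs) g ∎
    where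
    g : List _ → ℕ
    g us = ∑ (sublists ys) λ vs → f (us ++ vs)

  ∑-sublists-map : ∀ (h : A → B) xs f → ∑ (sublists (map h xs)) f ≡ ∑ (sublists xs) (f ∘ map h)
  ∑-sublists-map h [] f = refl
  ∑-sublists-map h (x ∷ xs) f = begin
    ∑ (map (h x ∷_) (sublists (map h xs)) ++ sublists (map h xs)) f
      ≡⟨ ∑-++ (map (h x ∷_) (sublists (map h xs))) _ f ⟩
    ∑ (map (h x ∷_) (sublists (map h xs))) f + ∑ (sublists (map h xs)) f
      ≡⟨ cong₂ _+_ (trans (∑-map (h x ∷_) (sublists (map h xs)) f) (∑-sublists-map h xs (f ∘ (h x ∷_))))
                   (∑-sublists-map h xs f) ⟩
    ∑ (sublists xs) (f ∘ map h ∘ (x ∷_)) + ∑ (sublists xs) (f ∘ map h)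
      ≡⟨ cong (_+ ∑ (sublists xs) (f ∘ map h)) (∑-map (x ∷_) (sublists xs) (f ∘ map h)) ⟨
    ∑ (map (x ∷_) (sublists xs)) (f ∘ map h) + ∑ (sublists xs) (f ∘ map h)
      ≡⟨ ∑-++ (map (x ∷_) (sublists xs)) _ (f ∘ map h) ⟨
    ∑ (map (x ∷_) (sublists xs) ++ sublists xs) (f ∘ map h) ∎

  ∑-sublists-empty : ∀ (xs : List A) f → (∀ y ys → f (y ∷ ys) ≡ 0) → ∑ (sublists xs) f ≡ f []
  ∑-sublists-empty [] f _ = +-identityʳ _
  ∑-sublists-empty (x ∷ xs) f f∷≡0 = begin
    ∑ (map (x ∷_) (sublists xs) ++ sublists xs) f           ≡⟨ ∑-++ (map (x ∷_) (sublists xs)) _ f ⟩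
    ∑ (map (x ∷_) (sublists xs)) f + ∑ (sublists xs) f      ≡⟨ cong₂ _+_ (∑-map (x ∷_) (sublists xs) f) (∑-sublists-empty xs f f∷≡0) ⟩
    ∑ (sublists xs) (f ∘ (x ∷_)) + f []                     ≡⟨ cong (_+ f []) (∑-zero (sublists xs) (f∷≡0 x)) ⟩
    f []                                                    ∎

  -- Meant for the blocks containing 0: with none of them 0 stays uncovered, and two of them would
  -- intersect, so only one-element families contribute.
  ∑-sublists-singleton : ∀ (xs : List A) f → f [] ≡ 0 → (∀ y z zs → f (y ∷ z ∷ zs) ≡ 0) →
    ∑ (sublists xs) f ≡ ∑ xs λ x → f (x ∷ [])
  ∑-sublists-singleton [] f f[]≡0 _ = trans (+-identityʳ _) f[]≡0
  ∑-sublists-singleton (x ∷ xs) f f[]≡0 f∷∷≡0 = begin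
    ∑ (map (x ∷_) (sublists xs) ++ sublists xs) f           ≡⟨ ∑-++ (map (x ∷_) (sublists xs)) _ f ⟩
    ∑ (map (x ∷_) (sublists xs)) f + ∑ (sublists xs) f
      ≡⟨ cong₂ _+_ (trans (∑-map (x ∷_) (sublists xs) f) (∑-sublists-empty xs (f ∘ (x ∷_)) (f∷∷≡0 x)))
                   (∑-sublists-singleton xs f f[]≡0 f∷∷≡0) ⟩
    f (x ∷ []) + ∑ xs (λ x → f (x ∷ []))                    ∎

  -- `IsSetPartition` with an arbitrary target `U` in place of `⊤`, so that what remains after
  -- removing a block is an object of the same kind in the same ambient set.
  PartitionOf : ∀ {m} → Subset m → List (Subset m) → Set
  PartitionOf U blocks =
    All Nonempty blocks × AllPairs (λ S T → Empty (S ∩ T)) blocks × ⋃ blocks ≡ U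

  partitionOf? : ∀ {m} (U : Subset m) → Decidable (PartitionOf U)
  partitionOf? U blocks =
    All.all? nonempty? blocks
    ×-dec allPairs? (λ S T → ¬? (nonempty? (S ∩ T))) blocks
    ×-dec ≡-dec _≟ᵇ_ (⋃ blocks) U

  pattern inside∷ S = inside ∷ᵛ S
  pattern outside∷ S = outside ∷ᵛ S

  ⋃-outside : ∀ {m} (F : List (Subset m)) → ⋃ (map outside∷ F) ≡ outside∷ (⋃ F)
  ⋃-outside [] = refl
  ⋃-outside (S ∷ F) rewrite ⋃-outside F = refl

  nonempty-outside⁺ : ∀ {m} {S : Subset m} → Nonempty S → Nonempty (outside∷ S)
  nonempty-outside⁺ (x , x∈S) = suc x , Vec.there x∈S

  nonempty-outside⁻ : ∀ {m} {S : Subset m} → Nonempty (outside∷ S) → Nonempty S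
  nonempty-outside⁻ (suc x , Vec.there x∈S) = x , x∈S

  partitionOf-outside⁺ : ∀ {m} {U : Subset m} {F} → PartitionOf U F → PartitionOf (outside∷ U) (map outside∷ F)
  partitionOf-outside⁺ {F = F} (ne , dis , ⋃≡) =
      All.map⁺ (All.map nonempty-outside⁺ ne)
    , AllPairs.map⁺ (AllPairs.map (_∘ nonempty-outside⁻) dis)
    , trans (⋃-outside F) (cong outside∷ ⋃≡)

  partitionOf-outside⁻ : ∀ {m} {U : Subset m} {F} → PartitionOf (outside∷ U) (map outside∷ F) → PartitionOf U F
  partitionOf-outside⁻ {F = F} (ne , dis , ⋃≡) =
      All.map nonempty-outside⁻ (All.map⁻ ne)
    , AllPairs.map (_∘ nonempty-outside⁺) (AllPairs.map⁻ dis)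
    , ∷-injectiveʳ (trans (sym (⋃-outside F)) ⋃≡)

  empty-∩-⋃⁻ : ∀ {m} (S : Subset m) F → All (λ T → Empty (S ∩ T)) F → ∀ {x} → x ∈ S → x ∉ ⋃ F
  empty-∩-⋃⁻ S [] [] _ x∈⊥ = ∉⊥ x∈⊥
  empty-∩-⋃⁻ S (T ∷ F) (S∩T=∅ ∷ rest) {x} x∈S x∈⋃ with x∈p∪q⁻ T (⋃ F) x∈⋃
  ... | inj₁ x∈T  = S∩T=∅ (x , x∈p∩q⁺ (x∈S , x∈T))
  ... | inj₂ x∈⋃F = empty-∩-⋃⁻ S F rest x∈S x∈⋃F

  empty-∩-⋃⁺ : ∀ {m} (S : Subset m) F → (∀ {x} → x ∈ S → x ∉ ⋃ F) → All (λ T → Empty (S ∩ T)) F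
  empty-∩-⋃⁺ S [] _ = []
  empty-∩-⋃⁺ S (T ∷ F) x∉ =
    (λ (x , x∈∩) → let x∈S , x∈T = x∈p∩q⁻ S T x∈∩ in x∉ x∈S (x∈p∪q⁺ (inj₁ x∈T)))
    ∷ empty-∩-⋃⁺ S F (λ x∈S x∈⋃F → x∉ x∈S (x∈p∪q⁺ {p = T} (inj₂ x∈⋃F)))

  x∈p─q⇒x∉q : ∀ {m} (p q : Subset m) {x} → x ∈ p ─ q → x ∉ q
  x∈p─q⇒x∉q (_ ∷ᵛ p) (inside∷ q) (Vec.there x∈) (Vec.there x∈q) = x∈p─q⇒x∉q p q x∈ x∈q
  x∈p─q⇒x∉q (_ ∷ᵛ p) (outside∷ q) (Vec.there x∈) (Vec.there x∈q) = x∈p─q⇒x∉q p q x∈ x∈q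

  partitionOf-inside⁻ : ∀ {m} {S U : Subset m} {F} →
    PartitionOf (inside∷ U) (inside∷ S ∷ map outside∷ F) → S ⊆ U × PartitionOf (U ─ S) F
  partitionOf-inside⁻ {S = S} {U} {F} (_ ∷ ne , S# ∷ dis , ⋃≡) = S⊆U , part
    where
    S∪⋃F≡U : S ∪ ⋃ F ≡ U
    S∪⋃F≡U = ∷-injectiveʳ (trans (cong ((inside∷ S) ∪_) (sym (⋃-outside F))) ⋃≡)
    S⊆U : S ⊆ U
    S⊆U x∈S = subst (_ ∈_) S∪⋃F≡U (x∈p∪q⁺ (inj₁ x∈S))
    S#⋃F : ∀ {x} → x ∈ S → x ∉ ⋃ F
    S#⋃F = empty-∩-⋃⁻ S F (All.map (λ { e (x , x∈) → e (suc x , Vec.there x∈) }) (All.map⁻ S#))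
    ⋃F⊆ : ⋃ F ⊆ U ─ S
    ⋃F⊆ x∈ = x∈p∧x∉q⇒x∈p─q (subst (_ ∈_) S∪⋃F≡U (x∈p∪q⁺ {p = S} (inj₂ x∈))) (λ x∈S → S#⋃F x∈S x∈)
    ⊆⋃F : U ─ S ⊆ ⋃ F
    ⊆⋃F x∈ with x∈p∪q⁻ S (⋃ F) (subst (_ ∈_) (sym S∪⋃F≡U) (p─q⊆p U S x∈))
    ... | inj₁ x∈S = contradiction x∈S (x∈p─q⇒x∉q U S x∈)
    ... | inj₂ x∈⋃F = x∈⋃F
    part : PartitionOf (U ─ S) F
    part = All.map nonempty-outside⁻ (All.map⁻ ne)
         , AllPairs.map (_∘ nonempty-outside⁺) (AllPairs.map⁻ dis)
         , ⊆-antisym ⋃F⊆ ⊆⋃F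

  partitionOf-inside⁺ : ∀ {m} {S U : Subset m} {F} →
    S ⊆ U × PartitionOf (U ─ S) F → PartitionOf (inside∷ U) (inside∷ S ∷ map outside∷ F)
  partitionOf-inside⁺ {S = S} {U} {F} (S⊆U , ne , dis , ⋃F≡U─S) =
      (zero , Vec.here) ∷ All.map⁺ (All.map nonempty-outside⁺ ne)
    , All.map⁺ (All.map (λ { e (suc x , Vec.there x∈) → e (x , x∈) })
                        (empty-∩-⋃⁺ S F λ x∈S x∈⋃F → x∈p─q⇒x∉q U S (subst (_ ∈_) ⋃F≡U─S x∈⋃F) x∈S))
      ∷ AllPairs.map⁺ (AllPairs.map (_∘ nonempty-outside⁻) dis)
    , trans (cong ((inside∷ S) ∪_) (⋃-outside F)) (cong inside∷ S∪⋃F≡U)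
    where
    S∪⋃F≡U : S ∪ ⋃ F ≡ U
    S∪⋃F≡U = ⊆-antisym to from
      where
      to : S ∪ ⋃ F ⊆ U
      to x∈ with x∈p∪q⁻ S (⋃ F) x∈
      ... | inj₁ x∈S = S⊆U x∈S
      ... | inj₂ x∈⋃F = p─q⊆p U S (subst (_ ∈_) ⋃F≡U─S x∈⋃F)
      from : U ⊆ S ∪ ⋃ F
      from {x} x∈U with x ∈? S
      ... | yes x∈S = x∈p∪q⁺ (inj₁ x∈S)
      ... | no x∉S = x∈p∪q⁺ {p = S} (inj₂ (subst (_ ∈_) (sym ⋃F≡U─S) (x∈p∧x∉q⇒x∈p─q x∈U x∉S)))

  partitionsOf : ∀ {m} → Subset m → ℕ
  partitionsOf {m} U = ∑ (sublists (allSubsets m)) (𝟙 ∘ partitionOf? U)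

  -- In `allSubsets` the subsets containing 0 come before the others, so each family is one of
  -- blocks through 0 followed by one of blocks avoiding 0.
  ∑-sublists-allSubsets-suc : ∀ m f → ∑ (sublists (allSubsets (suc m))) f ≡
    ∑ (sublists (allSubsets m)) λ F → ∑ (sublists (allSubsets m)) λ F′ →
      f (map inside∷ F ++ map outside∷ F′)
  ∑-sublists-allSubsets-suc m f = begin
    ∑ (sublists (map inside∷ subsets ++ map outside∷ subsets ++ [])) f
      ≡⟨ cong (λ xs → ∑ (sublists (map inside∷ subsets ++ xs)) f) (++-identityʳ (map outside∷ subsets)) ⟩
    ∑ (sublists (map inside∷ subsets ++ map outside∷ subsets)) f
      ≡⟨ ∑-sublists-++ (map inside∷ subsets) (map outside∷ subsets) f ⟩
    ∑ (sublists (map inside∷ subsets)) (λ F → ∑ (sublists (map outside∷ subsets)) λ F′ → f (F ++ F′))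
      ≡⟨ ∑-sublists-map inside∷ subsets _ ⟩
    ∑ (sublists subsets) (λ F → ∑ (sublists (map outside∷ subsets)) λ F′ → f (map inside∷ F ++ F′))
      ≡⟨ ∑-cong (sublists subsets) (λ F → ∑-sublists-map outside∷ subsets (λ F′ → f (map inside∷ F ++ F′))) ⟩
    ∑ (sublists subsets) (λ F → ∑ (sublists subsets) λ F′ → f (map inside∷ F ++ map outside∷ F′)) ∎
    where subsets = allSubsets m

  partitionsOf-outside : ∀ {m} (U : Subset m) → partitionsOf (outside∷ U) ≡ partitionsOf U
  partitionsOf-outside {m} U = begin
    partitionsOf (outside∷ U)
      ≡⟨ ∑-sublists-allSubsets-suc m (𝟙 ∘ partitionOf? (outside∷ U)) ⟩
    ∑ (sublists subsets) (λ F → ∑ (sublists subsets) λ F′ → 𝟙 (partitionOf? (outside∷ U) (map inside∷ F ++ map outside∷ F′)))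
      ≡⟨ ∑-sublists-empty subsets _ (λ S F → ∑-zero (sublists subsets) λ F′ →
           𝟙-no (partitionOf? (outside∷ U) (map inside∷ (S ∷ F) ++ map outside∷ F′)) (overflow S _)) ⟩
    ∑ (sublists subsets) (λ F′ → 𝟙 (partitionOf? (outside∷ U) (map outside∷ F′)))
      ≡⟨ ∑-cong (sublists subsets) (λ F′ → 𝟙-cong partitionOf-outside⁻ partitionOf-outside⁺
           (partitionOf? (outside∷ U) (map outside∷ F′)) (partitionOf? U F′)) ⟩
    partitionsOf U ∎
    where
    subsets = allSubsets m
    overflow : ∀ S F → ¬ PartitionOf (outside∷ U) (inside∷ S ∷ F)
    overflow S F (_ , _ , ⋃≡) with () ← subst (zero ∈_) ⋃≡ (p⊆p∪q {p = inside∷ S} (⋃ F) Vec.here)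

  -- A partition of a set containing 0 is the block of 0 and a partition of the rest.
  partitionsOf-inside : ∀ {m} (U : Subset m) →
    partitionsOf (inside∷ U) ≡ ∑ (allSubsets m) λ S → 𝟙 (S ⊆? U) * partitionsOf (U ─ S)
  partitionsOf-inside {m} U = begin
    partitionsOf (inside∷ U)
      ≡⟨ ∑-sublists-allSubsets-suc m (𝟙 ∘ partitionOf? (inside∷ U)) ⟩
    ∑ (sublists subsets) (λ F → ∑ (sublists subsets) λ F′ → 𝟙 (partitionOf? (inside∷ U) (map inside∷ F ++ map outside∷ F′)))
      ≡⟨ ∑-sublists-singleton subsets _
           (∑-zero (sublists subsets) λ F′ → 𝟙-no (partitionOf? (inside∷ U) (map outside∷ F′)) (uncovered F′))
           (λ S T F → ∑-zero (sublists subsets) λ F′ → 𝟙-no (partitionOf? (inside∷ U) (map inside∷ (S ∷ T ∷ F) ++ map outside∷ F′))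
             λ { (_ , (S#T ∷ _) ∷ _ , _) → S#T (zero , Vec.here) }) ⟩
    ∑ subsets (λ S → ∑ (sublists subsets) λ F′ → 𝟙 (partitionOf? (inside∷ U) (inside∷ S ∷ map outside∷ F′)))
      ≡⟨ ∑-cong subsets (λ S → trans (∑-cong (sublists subsets) (split S)) (∑-*ˡ (𝟙 (S ⊆? U)) (sublists subsets) _)) ⟩
    ∑ subsets (λ S → 𝟙 (S ⊆? U) * partitionsOf (U ─ S)) ∎
    where
    subsets = allSubsets m
    uncovered : ∀ F′ → ¬ PartitionOf (inside∷ U) (map outside∷ F′)
    uncovered F′ (_ , _ , ⋃≡) with () ← trans (sym (⋃-outside F′)) ⋃≡
    split : ∀ S F′ → 𝟙 (partitionOf? (inside∷ U) (inside∷ S ∷ map outside∷ F′))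
                     ≡ 𝟙 (S ⊆? U) * 𝟙 (partitionOf? (U ─ S) F′)
    split S F′ = trans
      (𝟙-cong partitionOf-inside⁻ partitionOf-inside⁺ (partitionOf? (inside∷ U) _)
        (S ⊆? U ×-dec partitionOf? (U ─ S) F′))
      (𝟙-× (S ⊆? U) (partitionOf? (U ─ S) F′))

  ∑-allSubsets-suc : ∀ m f → ∑ (allSubsets (suc m)) f ≡
    ∑ (allSubsets m) (λ S → f (inside∷ S)) + ∑ (allSubsets m) (λ S → f (outside∷ S))
  ∑-allSubsets-suc m f = begin
    ∑ (allSubsets (suc m)) f
      ≡⟨ ∑-cartesianProductWith Vec._∷_ (true ∷ false ∷ []) (allSubsets m) f ⟩
    ∑ (allSubsets m) (λ S → f (inside∷ S)) + (∑ (allSubsets m) (λ S → f (outside∷ S)) + 0)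
      ≡⟨ cong (∑ (allSubsets m) (λ S → f (inside∷ S)) +_) (+-identityʳ _) ⟩
    ∑ (allSubsets m) (λ S → f (inside∷ S)) + ∑ (allSubsets m) (λ S → f (outside∷ S)) ∎

  -- For 0 in `U`, putting 0 into S or leaving it out keeps |U ─ S| or raises it by one; these
  -- choices give the two terms of `extensions-pascal₀`. The shift `h` records elements already left
  -- out.
  ∑-subsets-bellNumber : ∀ {m} (U : Subset m) h →
    ∑ (allSubsets m) (λ S → 𝟙 (S ⊆? U) * bellNumber (∣ U ─ S ∣ + h)) ≡ extensions (suc (∣ U ∣ + h)) 0 ∣ U ∣
  ∑-subsets-bellNumber {zero} []ᵛ h = trans (trans (+-identityʳ _) (+-identityʳ _)) (sym (extensions-none h))
  ∑-subsets-bellNumber {suc m} (outside∷ U) h = begin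
    ∑ (allSubsets (suc m)) f
      ≡⟨ ∑-allSubsets-suc m f ⟩
    ∑ subsets (λ S → f (inside∷ S)) + ∑ subsets (λ S → f (outside∷ S))
      ≡⟨ cong₂ _+_ (∑-zero subsets λ S → cong (_* bellNumber (∣ U ─ S ∣ + h)) (𝟙-no (inside∷ S ⊆? outside∷ U) λ S⊆U → zero∉U (S⊆U Vec.here)))
                   (∑-cong subsets λ S → cong (_* bellNumber (∣ U ─ S ∣ + h)) (𝟙-cong drop-∷-⊆ out⊆ (outside∷ S ⊆? outside∷ U) (S ⊆? U))) ⟩
    ∑ subsets (λ S → 𝟙 (S ⊆? U) * bellNumber (∣ U ─ S ∣ + h))
      ≡⟨ ∑-subsets-bellNumber U h ⟩
    extensions (suc (∣ U ∣ + h)) 0 ∣ U ∣ ∎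
    where
    subsets = allSubsets m
    f = λ S → 𝟙 (S ⊆? outside∷ U) * bellNumber (∣ outside∷ U ─ S ∣ + h)
    zero∉U : ¬ (zero ∈ outside∷ U)
    zero∉U ()
  ∑-subsets-bellNumber {suc m} (inside∷ U) h = begin
    ∑ (allSubsets (suc m)) f
      ≡⟨ ∑-allSubsets-suc m f ⟩
    ∑ subsets (λ S → f (inside∷ S)) + ∑ subsets (λ S → f (outside∷ S))
      ≡⟨ cong₂ _+_ (∑-cong subsets λ S → cong (_* bellNumber (∣ U ─ S ∣ + h)) (𝟙-cong drop-∷-⊆ in⊆in (inside∷ S ⊆? inside∷ U) (S ⊆? U)))
                   (∑-cong subsets λ S → cong₂ (λ i j → i * bellNumber j)
                      (𝟙-cong drop-∷-⊆ out⊆ (outside∷ S ⊆? inside∷ U) (S ⊆? U)) (sym (+-suc ∣ U ─ S ∣ h))) ⟩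
    ∑ subsets (λ S → 𝟙 (S ⊆? U) * bellNumber (∣ U ─ S ∣ + h)) + ∑ subsets (λ S → 𝟙 (S ⊆? U) * bellNumber (∣ U ─ S ∣ + suc h))
      ≡⟨ cong₂ _+_ (∑-subsets-bellNumber U h) (∑-subsets-bellNumber U (suc h)) ⟩
    extensions (suc (u + h)) 0 u + extensions (suc (u + suc h)) 0 u
      ≡⟨ +-comm (extensions (suc (u + h)) 0 u) _ ⟩
    extensions (suc (u + suc h)) 0 u + extensions (suc (u + h)) 0 u
      ≡⟨ cong (λ t → extensions (suc t) 0 u + extensions (suc (u + h)) 0 u) (+-suc u h) ⟩
    extensions (2 + (u + h)) 0 u + extensions (suc (u + h)) 0 u
      ≡⟨ extensions-pascal₀ (s≤s (m≤m+n u h)) ⟨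
    extensions (2 + (u + h)) 0 (suc u) ∎
    where
    subsets = allSubsets m
    u = ∣ U ∣
    f = λ S → 𝟙 (S ⊆? inside∷ U) * bellNumber (∣ inside∷ U ─ S ∣ + h)

  partitionsOf≡bellNumber : ∀ {m} (U : Subset m) → partitionsOf U ≡ bellNumber ∣ U ∣
  partitionsOf≡bellNumber []ᵛ = refl
  partitionsOf≡bellNumber (outside∷ U) = trans (partitionsOf-outside U) (partitionsOf≡bellNumber U)
  partitionsOf≡bellNumber {suc m} (inside∷ U) = begin
    partitionsOf (inside∷ U)
      ≡⟨ partitionsOf-inside U ⟩
    ∑ (allSubsets m) (λ S → 𝟙 (S ⊆? U) * partitionsOf (U ─ S))
      -- The remainder `U ─ S` lives in an ambient set of size `m`, one smaller, so the recursion is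
      -- structural whatever its cardinality.
      ≡⟨ ∑-cong (allSubsets m) (λ S → cong (𝟙 (S ⊆? U) *_)
           (trans (partitionsOf≡bellNumber (U ─ S)) (cong bellNumber (sym (+-identityʳ ∣ U ─ S ∣))))) ⟩
    ∑ (allSubsets m) (λ S → 𝟙 (S ⊆? U) * bellNumber (∣ U ─ S ∣ + 0))
      ≡⟨ ∑-subsets-bellNumber U 0 ⟩
    extensions (suc (∣ U ∣ + 0)) 0 ∣ U ∣
      ≡⟨ cong (λ t → extensions (suc t) 0 ∣ U ∣) (+-identityʳ ∣ U ∣) ⟩
    extensions (suc ∣ U ∣) 0 ∣ U ∣
      ≡⟨ extensions-top ∣ U ∣ ⟨
    bellNumber (suc ∣ U ∣) ∎

  bell≡bellNumber : ∀ m → bell m ≡ bellNumber m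
  bell≡bellNumber m = begin
    bell m                                    ≡⟨ length-filter isSetPartition? (sublists (allSubsets m)) ⟩
    ∑ (sublists (allSubsets m)) (𝟙 ∘ isSetPartition?) ≡⟨ ∑-cong (sublists (allSubsets m)) (λ F → 𝟙-cong id id (isSetPartition? F) (partitionOf? ⊤ F)) ⟩
    partitionsOf (⊤ {m})                      ≡⟨ partitionsOf≡bellNumber (⊤ {m}) ⟩
    bellNumber ∣ ⊤ {m} ∣                      ≡⟨ cong bellNumber (∣⊤∣≡n m) ⟩
    bellNumber m                              ∎

  -- Repetition-free words over a shrinking alphabet

  ∑-words-filter : ∀ {P : A → Set} (P? : Decidable P) R n (h : Vec A n → ℕ) →
    ∑ (words R n) (λ w → 𝟙 (VecAll.all? P? w) * h w) ≡ ∑ (words (filter P? R) n) h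
  ∑-words-filter P? R zero h = cong (_+ 0) (+-identityʳ _)
  ∑-words-filter P? R (suc n) h = begin
    ∑ (words R (suc n)) (λ w → 𝟙 (VecAll.all? P? w) * h w)
      ≡⟨ ∑-cartesianProductWith _∷ᵛ_ R (words R n) _ ⟩
    ∑ R (λ a → ∑ (words R n) λ w → 𝟙 (VecAll.all? P? (a ∷ᵛ w)) * h (a ∷ᵛ w))
      ≡⟨ ∑-cong R (λ a → trans
           (∑-cong (words R n) λ w → trans (cong (_* h (a ∷ᵛ w)) (𝟙-× (P? a) (VecAll.all? P? w)))
                                           (*-assoc (𝟙 (P? a)) _ _))
           (∑-*ˡ (𝟙 (P? a)) (words R n) _)) ⟩
    ∑ R (λ a → 𝟙 (P? a) * ∑ (words R n) λ w → 𝟙 (VecAll.all? P? w) * h (a ∷ᵛ w))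
      ≡⟨ ∑-cong R (λ a → cong (𝟙 (P? a) *_) (∑-words-filter P? R n (h ∘ (a ∷ᵛ_)))) ⟩
    ∑ R (λ a → 𝟙 (P? a) * ∑ (words (filter P? R) n) (h ∘ (a ∷ᵛ_)))
      ≡⟨ ∑-filter P? R _ ⟨
    ∑ (filter P? R) (λ a → ∑ (words (filter P? R) n) (h ∘ (a ∷ᵛ_)))
      ≡⟨ ∑-cartesianProductWith _∷ᵛ_ (filter P? R) (words (filter P? R) n) h ⟨
    ∑ (words (filter P? R) (suc n)) h ∎

  _without_ : List ℕ → ℕ → List ℕ
  R without b = filter (λ a → ¬? (b ≟ a)) R

  ∑-unique-words-suc : ∀ R n (h : Vec ℕ (suc n) → ℕ) →
    ∑ (words R (suc n)) (λ w → 𝟙 (unique? w) * h w)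
    ≡ ∑ R λ b → ∑ (words (R without b) n) λ w → 𝟙 (unique? w) * h (b ∷ᵛ w)
  ∑-unique-words-suc R n h = begin
    ∑ (words R (suc n)) (λ w → 𝟙 (unique? w) * h w)
      ≡⟨ ∑-cartesianProductWith _∷ᵛ_ R (words R n) _ ⟩
    ∑ R (λ b → ∑ (words R n) λ w → 𝟙 (unique? (b ∷ᵛ w)) * h (b ∷ᵛ w))
      ≡⟨ ∑-cong R (λ b → ∑-cong (words R n) λ w → trans
           (cong (_* h (b ∷ᵛ w)) (𝟙-× (VecAll.all? (λ a → ¬? (b ≟ a)) w) (unique? w)))
           (*-assoc (𝟙 (VecAll.all? (λ a → ¬? (b ≟ a)) w)) _ _)) ⟩
    ∑ R (λ b → ∑ (words R n) λ w → 𝟙 (VecAll.all? (λ a → ¬? (b ≟ a)) w) * (𝟙 (unique? w) * h (b ∷ᵛ w)))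
      -- Forbidding `b` in every later place is the same as deleting it from the alphabet.
      ≡⟨ ∑-cong R (λ b → ∑-words-filter (λ a → ¬? (b ≟ a)) R n (λ w → 𝟙 (unique? w) * h (b ∷ᵛ w))) ⟩
    ∑ R (λ b → ∑ (words (R without b) n) λ w → 𝟙 (unique? w) * h (b ∷ᵛ w)) ∎

  length-without-< : ∀ {R b} → b ∈ᴸ R → length (R without b) < length R
  length-without-< {R} {b} b∈R = filter-notAll (λ a → ¬? (b ≟ a)) R (Any.map (λ e ¬e → ¬e e) b∈R)

  -- Pigeonhole: each letter written deletes at least one entry from the alphabet, which is
  -- exhausted before `n` letters are placed.
  ∑-unique-words-short : ∀ R n (h : Vec ℕ n → ℕ) → length R < n → ∑ (words R n) (λ w → 𝟙 (unique? w) * h w) ≡ 0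
  ∑-unique-words-short R (suc n) h (s≤s ∣R∣≤n) = begin
    ∑ (words R (suc n)) (λ w → 𝟙 (unique? w) * h w)
      ≡⟨ ∑-unique-words-suc R n h ⟩
    ∑ R (λ b → ∑ (words (R without b) n) λ w → 𝟙 (unique? w) * h (b ∷ᵛ w))
      ≡⟨ ∑-cong-local (All.tabulate {xs = R} λ {b} b∈R →
           ∑-unique-words-short (R without b) n (h ∘ (b ∷ᵛ_)) (<-≤-trans (length-without-< b∈R) ∣R∣≤n)) ⟩
    ∑ R (λ _ → 0)
      ≡⟨ ∑-zero R (λ _ → refl) ⟩
    0 ∎

  -- Ranks in an increasing alphabet and the count of arrangements

  Sorted : List ℕ → Set
  Sorted = AllPairs _<_

  below : ℕ → List ℕ → ℕ
  below p R = ∑ R λ r → 𝟙 (r <? p)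

  length-without : ∀ {R b} → Sorted R → b ∈ᴸ R → suc (length (R without b)) ≡ length R
  length-without {r ∷ R} {b} (r<R ∷ _) (here refl)
    rewrite filter-reject (λ a → ¬? (r ≟ a)) {r} {R} (λ ¬r≡r → ¬r≡r refl)
          | filter-all (λ a → ¬? (r ≟ a)) (All.map <⇒≢ r<R) = refl
  length-without {r ∷ R} {b} (r<R ∷ sR) (there b∈R)
    rewrite filter-accept (λ a → ¬? (b ≟ a)) {r} {R} (>⇒≢ (All.lookup r<R b∈R))
    = cong suc (length-without sR b∈R)

  below-without : ∀ b R → below b (R without b) ≡ below b R
  below-without b R = trans (∑-filter (λ a → ¬? (b ≟ a)) R (λ r → 𝟙 (r <? b))) (∑-cong R eq)
    where
    eq : ∀ r → 𝟙 (¬? (b ≟ r)) * 𝟙 (r <? b) ≡ 𝟙 (r <? b)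
    eq r = trans (sym (𝟙-× (¬? (b ≟ r)) (r <? b)))
                 (𝟙-cong proj₂ (λ r<b → >⇒≢ r<b , r<b) (¬? (b ≟ r) ×-dec (r <? b)) (r <? b))

  below-none : ∀ {p R} → All (p ≤_) R → below p R ≡ 0
  below-none [] = refl
  below-none {p} {r ∷ R} (p≤r ∷ p≤R) = cong₂ _+_ (𝟙-no (r <? p) (≤⇒≯ p≤r)) (below-none p≤R)

  below-all : ∀ {p R} → All (_< p) R → below p R ≡ length R
  below-all [] = refl
  below-all {p} {r ∷ R} (r<p ∷ R<p) = cong₂ _+_ (𝟙-yes (r <? p) r<p) (below-all R<p)

  below-∷ : ∀ {r b R} → r < b → below b (r ∷ R) ≡ suc (below b R)
  below-∷ {r} {b} r<b = cong (_+ _) (𝟙-yes (r <? b) r<b)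

  -- In a strictly increasing list the entries have ranks 0, 1, 2, ..., and those below `p` are an
  -- initial segment.
  ∑-ranks-below : ∀ {R} p (f : ℕ → ℕ) → Sorted R →
    ∑ R (λ b → 𝟙 (b <? p) * f (below b R)) ≡ ∑ (upTo (below p R)) f
  ∑-ranks-below {[]} p f [] = refl
  ∑-ranks-below {r ∷ R} p f (r<R ∷ sR) = begin
    𝟙 (r <? p) * f (below r (r ∷ R)) + ∑ R (λ b → 𝟙 (b <? p) * f (below b (r ∷ R)))
      ≡⟨ cong₂ _+_ (cong (λ i → 𝟙 (r <? p) * f i) (below-none (≤-refl ∷ All.map <⇒≤ r<R)))
                   (∑-cong-local (All.map (λ {b} r<b → cong (λ i → 𝟙 (b <? p) * f i) (below-∷ {R = R} r<b)) r<R)) ⟩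
    𝟙 (r <? p) * f 0 + ∑ R (λ b → 𝟙 (b <? p) * f (suc (below b R)))
      ≡⟨ cong (𝟙 (r <? p) * f 0 +_) (∑-ranks-below p (f ∘ suc) sR) ⟩
    𝟙 (r <? p) * f 0 + ∑ (upTo (below p R)) (f ∘ suc)
      ≡⟨ assemble (r <? p) ⟩
    ∑ (upTo (below p (r ∷ R))) f ∎
    where
    assemble : (d : Dec (r < p)) → 𝟙 d * f 0 + ∑ (upTo (below p R)) (f ∘ suc) ≡ ∑ (upTo (below p (r ∷ R))) f
    assemble (yes r<p) rewrite below-∷ {R = R} r<p =
      trans (cong (_+ ∑ (upTo (below p R)) (f ∘ suc)) (+-identityʳ (f 0))) (sym (∑-upTo-sucˡ (below p R) f))
    assemble (no r≮p)
      rewrite below-none {p} {r ∷ R} (≮⇒≥ r≮p ∷ All.map (λ r<b → ≤-trans (≮⇒≥ r≮p) (<⇒≤ r<b)) r<R)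
            | below-none {p} {R} (All.map (λ r<b → ≤-trans (≮⇒≥ r≮p) (<⇒≤ r<b)) r<R) = refl

  -- Only the maximum of `R` passes the test, and its rank is `pred (length R)`. As `p` is not in
  -- `R`, the maximum exceeds `p` exactly when not every entry lies below `p`.
  ∑-maximum-above : ∀ {R} p (f : ℕ → ℕ) → Sorted R → All (p ≢_) R →
    ∑ R (λ b → 𝟙 (p <? b) * (𝟙 (All.all? (_≤? b) R) * f (below b R)))
    ≡ 𝟙 (below p R <? length R) * f (pred (length R))
  -- The indicator is that of 0 < 0, so the default value `pred 0` never enters.
  ∑-maximum-above {[]} p f [] [] = refl
  ∑-maximum-above {r ∷ []} p f _ (p≢r ∷ []) with <-cmp p r
  ... | tri< p<r _ _
    rewrite 𝟙-yes (p <? r) p<r | 𝟙-yes (All.all? (_≤? r) (r ∷ [])) (≤-refl ∷ [])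
          | 𝟙-no (r <? p) (<-asym p<r) | 𝟙-no (r <? r) (<-irrefl refl)
    = trans (+-identityʳ _) (+-identityʳ _)
  ... | tri≈ _ p≡r _ = contradiction p≡r p≢r
  ... | tri> _ _ r<p rewrite 𝟙-no (p <? r) (<-asym r<p) | 𝟙-yes (r <? p) r<p = refl
  ∑-maximum-above {r ∷ R@(s ∷ _)} p f (r<R@(r<s ∷ _) ∷ sR) (p≢r ∷ p≢R) = begin
    𝟙 (p <? r) * (𝟙 (All.all? (_≤? r) (r ∷ R)) * f (below r (r ∷ R)))
      + ∑ R (λ b → 𝟙 (p <? b) * (𝟙 (All.all? (_≤? b) (r ∷ R)) * f (below b (r ∷ R))))
      -- The head `r` is smaller than `s`, hence not the maximum; dropping it lowers every other
      -- rank by one, which turns `f` into `f ∘ suc`.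
      ≡⟨ cong₂ _+_
           (trans (cong (λ i → 𝟙 (p <? r) * (i * f (below r (r ∷ R))))
                    (𝟙-no (All.all? (_≤? r) (r ∷ R)) λ { (_ ∷ s≤r ∷ _) → <⇒≱ r<s s≤r }))
                  (*-zeroʳ (𝟙 (p <? r))))
           (∑-cong-local (All.map (λ {b} r<b → cong₂ (λ i j → 𝟙 (p <? b) * (i * f j))
              (𝟙-cong (λ { (_ ∷ R≤b) → R≤b }) (<⇒≤ r<b ∷_) (All.all? (_≤? b) (r ∷ R)) (All.all? (_≤? b) R))
              (below-∷ {R = R} r<b)) r<R)) ⟩
    ∑ R (λ b → 𝟙 (p <? b) * (𝟙 (All.all? (_≤? b) R) * f (suc (below b R))))
      ≡⟨ ∑-maximum-above p (f ∘ suc) sR p≢R ⟩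
    𝟙 (below p R <? length R) * f (length R)
      ≡⟨ cong (_* f (length R)) someBelow ⟩
    𝟙 (below p (r ∷ R) <? length (r ∷ R)) * f (length R) ∎
    where
    someBelow : 𝟙 (below p R <? length R) ≡ 𝟙 (below p (r ∷ R) <? length (r ∷ R))
    someBelow with <-cmp p r
    ... | tri< p<r _ _ = trans (𝟙-yes (below p R <? length R) (subst (_< length R) (sym (below-none p≤R)) z<s))
                        (sym (𝟙-yes (below p (r ∷ R) <? length (r ∷ R)) (subst (_< length (r ∷ R)) (sym (below-none (<⇒≤ p<r ∷ p≤R))) z<s)))
      where
      p≤R : All (p ≤_) R
      p≤R = All.map (λ r<b → <⇒≤ (<-trans p<r r<b)) r<R
    ... | tri≈ _ p≡r _ = contradiction p≡r p≢r
    ... | tri> _ _ r<p rewrite below-∷ {R = R} r<p = 𝟙-cong s<s s<s⁻¹ (below p R <? length R) (suc (below p R) <? suc (length R))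

  -- The condition on p w read one letter at a time, to match the recursion of `extensions`. After
  -- an ascent to `b` no later c may satisfy b < c, hence `_≤ b`; a forced descent restricts no
  -- later letter.
  Continues : ∀ {n} → ℕ → ℕ → Vec ℕ n → Set
  Continues zero    p []ᵛ      = Unit.⊤
  Continues (suc k) p []ᵛ      = Empty.⊥
  Continues zero    p (b ∷ᵛ w) = (p < b → VecAll.All (_≤ b) w) × Continues 0 b w
  Continues (suc k) p (b ∷ᵛ w) = b < p × Continues k b w

  continues? : ∀ {n} k p → Decidable (Continues {n} k p)
  continues? zero    p []ᵛ      = yes Unit.tt
  continues? (suc k) p []ᵛ      = no λ ()
  continues? zero    p (b ∷ᵛ w) = (p <? b →-dec VecAll.all? (_≤? b) w) ×-dec continues? 0 b w
  continues? (suc k) p (b ∷ᵛ w) = b <? p ×-dec continues? k b w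

  arrangements : ℕ → ℕ → ℕ → List ℕ → ℕ
  arrangements n k p R = ∑ (words R n) λ w → 𝟙 (unique? w) * 𝟙 (continues? k p w)

  -- `p` matters only through its rank, which lets the induction replace it by the next letter.
  -- Since `p` is not in `R`, every first letter is a strict descent or a strict ascent. The
  -- signature stands apart from the body because the two lemmas that follow call it at the smaller
  -- length.
  arrangements≡extensions : ∀ t k p {R} → Sorted R → length R ≡ t → All (p ≢_) R →
    arrangements t k p R ≡ extensions t k (below p R)

  arrangements-after : ∀ t k {R b} → Sorted R → length R ≡ suc t → b ∈ᴸ R →
    arrangements t k b (R without b) ≡ extensions t k (below b R)
  arrangements-after t k {R} {b} sR ∣R∣ b∈R = trans
    (arrangements≡extensions t k b (AllPairs.filter⁺ _ sR)
      (suc-injective (trans (length-without sR b∈R) ∣R∣)) (All.all-filter (λ a → ¬? (b ≟ a)) R))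
    (cong (extensions t k) (below-without b R))

  -- By pigeonhole, the words after an ascent to b use every other letter, so b
  -- must be the largest one.
  arrangements-ascent : ∀ t {R b} → Sorted R → length R ≡ suc t → b ∈ᴸ R →
    ∑ (words (R without b) t) (λ w → 𝟙 (VecAll.all? (_≤? b) w) * (𝟙 (unique? w) * 𝟙 (continues? 0 b w)))
    ≡ 𝟙 (All.all? (_≤? b) R) * extensions t 0 (below b R)
  arrangements-ascent t {R} {b} sR ∣R∣ b∈R = trans
    (∑-words-filter (_≤? b) (R without b) t (λ w → 𝟙 (unique? w) * 𝟙 (continues? 0 b w)))
    (helper (All.all? (_≤? b) R))
    where
    helper : (d : Dec (All (_≤ b) R)) →
      arrangements t 0 b (filter (_≤? b) (R without b)) ≡ 𝟙 d * extensions t 0 (below b R)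
    helper (yes R≤b) = trans
      (cong (arrangements t 0 b) (filter-all (_≤? b) (All.filter⁺ _ R≤b)))
      (trans (arrangements-after t 0 sR ∣R∣ b∈R) (sym (+-identityʳ _)))
    helper (no ¬R≤b) = ∑-unique-words-short _ t _ (subst (length (filter (_≤? b) (R without b)) <_)
      (suc-injective (trans (length-without sR b∈R) ∣R∣))
      (filter-notAll (_≤? b) (R without b) (All.¬All⇒Any¬ (_≤? b) _ (¬R≤b ∘ restore))))
      where
      restore : All (_≤ b) (R without b) → All (_≤ b) R
      restore R′≤b = All.tabulate λ {a} a∈R → bound a∈R (b ≟ a)
        where
        bound : ∀ {a} → a ∈ᴸ R → Dec (b ≡ a) → a ≤ b
        bound _ (yes refl) = ≤-refl
        bound a∈R (no b≢a) = All.lookup R′≤b (∈-filter⁺ (λ a → ¬? (b ≟ a)) a∈R b≢a)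

  arrangements≡extensions zero zero p {[]} _ _ _ = refl
  arrangements≡extensions zero (suc k) p {[]} _ _ _ = refl
  arrangements≡extensions (suc t) (suc k) p {R} sR ∣R∣ p∉R = begin
    arrangements (suc t) (suc k) p R
      ≡⟨ ∑-unique-words-suc R t (λ w → 𝟙 (continues? (suc k) p w)) ⟩
    ∑ R (λ b → ∑ (words (R without b) t) λ w → 𝟙 (unique? w) * 𝟙 (b <? p ×-dec continues? k b w))
      ≡⟨ ∑-cong R (λ b → trans
           (∑-cong (words (R without b) t) λ w → trans (cong (𝟙 (unique? w) *_) (𝟙-× (b <? p) (continues? k b w)))
                                                        (*-swap (𝟙 (unique? w)) (𝟙 (b <? p)) _))
           (∑-*ˡ (𝟙 (b <? p)) (words (R without b) t) _)) ⟩
    ∑ R (λ b → 𝟙 (b <? p) * arrangements t k b (R without b))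
      ≡⟨ ∑-cong-local (All.tabulate λ {b} b∈R → cong (𝟙 (b <? p) *_) (arrangements-after t k sR ∣R∣ b∈R)) ⟩
    ∑ R (λ b → 𝟙 (b <? p) * extensions t k (below b R))
      ≡⟨ ∑-ranks-below p (extensions t k) sR ⟩
    ∑ (upTo (below p R)) (extensions t k) ∎
  arrangements≡extensions (suc t) zero p {R} sR ∣R∣ p∉R = begin
    arrangements (suc t) zero p R
      ≡⟨ ∑-unique-words-suc R t (λ w → 𝟙 (continues? 0 p w)) ⟩
    ∑ R (λ b → ∑ (words (R without b) t) λ w → 𝟙 (unique? w) * 𝟙 (continues? 0 p (b ∷ᵛ w)))
      -- For each first letter exactly one of the comparisons with `p` holds; the second product
      -- keeps an ascent only if it goes to the maximum.
      ≡⟨ ∑-cong-local (All.tabulate λ {b} b∈R → first b b∈R) ⟩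
    ∑ R (λ b → 𝟙 (b <? p) * f (below b R) + 𝟙 (p <? b) * (𝟙 (All.all? (_≤? b) R) * f (below b R)))
      ≡⟨ ∑-+ R (λ b → 𝟙 (b <? p) * f (below b R)) _ ⟩
    ∑ R (λ b → 𝟙 (b <? p) * f (below b R)) + ∑ R (λ b → 𝟙 (p <? b) * (𝟙 (All.all? (_≤? b) R) * f (below b R)))
      ≡⟨ cong₂ _+_ (∑-ranks-below p f sR) (∑-maximum-above p f sR p∉R) ⟩
    ∑ (upTo (below p R)) f + 𝟙 (below p R <? length R) * f (pred (length R))
      ≡⟨ cong (λ n → ∑ (upTo (below p R)) f + 𝟙 (below p R <? n) * f (pred n)) ∣R∣ ⟩
    extensions (suc t) 0 (below p R) ∎
    where
    f = extensions t 0
    first : ∀ b → b ∈ᴸ R →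
      ∑ (words (R without b) t) (λ w → 𝟙 (unique? w) * 𝟙 (continues? 0 p (b ∷ᵛ w)))
      ≡ 𝟙 (b <? p) * f (below b R) + 𝟙 (p <? b) * (𝟙 (All.all? (_≤? b) R) * f (below b R))
    first b b∈R with <-cmp p b
    ... | tri≈ _ p≡b _ = contradiction p≡b (All.lookup p∉R b∈R)
    ... | tri> p≮b _ b<p rewrite 𝟙-yes (b <? p) b<p | 𝟙-no (p <? b) p≮b = trans
      (∑-cong (words (R without b) t) λ w → cong (𝟙 (unique? w) *_)
        (𝟙-cong proj₂ (λ c → (λ p<b → contradiction p<b p≮b) , c) (continues? 0 p (b ∷ᵛ w)) (continues? 0 b w)))
      (trans (arrangements-after t 0 sR ∣R∣ b∈R) (lemma (f (below b R))))
      where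
      lemma : ∀ a → a ≡ a + 0 + 0
      lemma a = sym (trans (+-identityʳ (a + 0)) (+-identityʳ a))
    ... | tri< p<b _ b≮p rewrite 𝟙-no (b <? p) b≮p | 𝟙-yes (p <? b) p<b = trans
      (∑-cong (words (R without b) t) λ w → trans
        (cong (𝟙 (unique? w) *_) (trans
          (𝟙-cong (λ (a , c) → a p<b , c) (λ (a , c) → (λ _ → a) , c)
            (continues? 0 p (b ∷ᵛ w)) (VecAll.all? (_≤? b) w ×-dec continues? 0 b w))
          (𝟙-× (VecAll.all? (_≤? b) w) (continues? 0 b w))))
        (*-swap (𝟙 (unique? w)) (𝟙 (VecAll.all? (_≤? b) w)) _))
      (trans (arrangements-ascent t sR ∣R∣ b∈R) (sym (+-identityʳ _)))

  -- Avoidance of 12-3 and decreasing prefixes, letter by letter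

  both : P → Q → P ⇔ Q
  both p q = mk⇔ (λ _ → q) (λ _ → p)

  neither : ¬ P → ¬ Q → P ⇔ Q
  neither ¬p ¬q = mk⇔ (λ p → contradiction p ¬p) (λ q → contradiction q ¬q)

  increasing⇒123 : ∀ {a b c} → a < b → b < c →
    OrderIsomorphic (a ∷ᵛ b ∷ᵛ c ∷ᵛ []ᵛ) (1 ∷ᵛ 2 ∷ᵛ 3 ∷ᵛ []ᵛ)
  increasing⇒123 a<b b<c zero zero = neither (<-irrefl refl) (<-irrefl refl)
  increasing⇒123 a<b b<c zero (suc zero) = both a<b (s<s z<s)
  increasing⇒123 a<b b<c zero (suc (suc zero)) = both (<-trans a<b b<c) (s<s z<s)
  increasing⇒123 a<b b<c (suc zero) zero = neither (<-asym a<b) (<-asym (s<s z<s))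
  increasing⇒123 a<b b<c (suc zero) (suc zero) = neither (<-irrefl refl) (<-irrefl refl)
  increasing⇒123 a<b b<c (suc zero) (suc (suc zero)) = both b<c (s<s (s<s z<s))
  increasing⇒123 a<b b<c (suc (suc zero)) zero = neither (<-asym (<-trans a<b b<c)) (<-asym (s<s z<s))
  increasing⇒123 a<b b<c (suc (suc zero)) (suc zero) = neither (<-asym b<c) (<-asym (s<s (s<s z<s)))
  increasing⇒123 a<b b<c (suc (suc zero)) (suc (suc zero)) = neither (<-irrefl refl) (<-irrefl refl)

  123⇒increasing : ∀ {a b c} → OrderIsomorphic (a ∷ᵛ b ∷ᵛ c ∷ᵛ []ᵛ) (1 ∷ᵛ 2 ∷ᵛ 3 ∷ᵛ []ᵛ) →
    a < b × b < c
  123⇒increasing iso =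
    Equivalence.from (iso zero (suc zero)) (s<s z<s) , Equivalence.from (iso (suc zero) (suc (suc zero))) (s<s (s<s z<s))

  avoids-[-] : ∀ p → Avoids12-3 (p ∷ᵛ []ᵛ)
  avoids-[-] p (zero , zero , _ , () , _)

  -- The first two letters of an occurrence are adjacent, so one that uses `p` has `b` as its second
  -- letter; any other lies in `b ∷ᵛ w`.
  avoids-∷⁺ : ∀ {n p b} {w : Vec ℕ n} →
    (p < b → VecAll.All (_≤ b) w) → Avoids12-3 (b ∷ᵛ w) → Avoids12-3 (p ∷ᵛ b ∷ᵛ w)
  avoids-∷⁺ w≤b _ (zero , suc zero , suc (suc j) , _ , _ , iso) =
    let p<b , b<c = 123⇒increasing iso in <⇒≱ b<c (lookup⁺ (w≤b p<b) j)
  avoids-∷⁺ _ _ (zero , suc zero , suc zero , _ , s<s () , _)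
  avoids-∷⁺ _ av (suc i , suc i′ , suc j , i′≡ , s<s i′<j , iso) =
    av (i , i′ , j , suc-injective i′≡ , i′<j , iso)

  avoids-∷⁻ : ∀ {n p b} {w : Vec ℕ n} →
    Avoids12-3 (p ∷ᵛ b ∷ᵛ w) → p < b → VecAll.All (_≤ b) w
  avoids-∷⁻ av p<b = lookup⁻ λ j → ≮⇒≥ λ b<c →
    av (zero , suc zero , suc (suc j) , refl , s<s z<s , increasing⇒123 p<b b<c)

  avoids-tail : ∀ {n p} {w : Vec ℕ n} → Avoids12-3 (p ∷ᵛ w) → Avoids12-3 w
  avoids-tail av (i , i′ , j , i′≡ , i′<j , iso) =
    av (suc i , suc i′ , suc j , cong suc i′≡ , s<s i′<j , iso)

  -- A letter above all of `w` starts no ascent. This serves for the virtual first letter.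
  avoids-descent⁺ : ∀ {n p} {w : Vec ℕ n} → VecAll.All (_< p) w → Avoids12-3 w → Avoids12-3 (p ∷ᵛ w)
  avoids-descent⁺ {w = []ᵛ} _ _ = avoids-[-] _
  avoids-descent⁺ {w = b ∷ᵛ w} (b<p VecAll.∷ _) = avoids-∷⁺ (contradiction b<p ∘ <-asym)

  lookup-decreasing-≤ : ∀ k i → lookup (decreasing k) i ≤ k
  lookup-decreasing-≤ k i rewrite lookup∘tabulate (λ i → k ∸ toℕ i) i = m∸n≤m k (toℕ i)

  -- `decreasing (suc k)` unfolds to `suc k` followed by `decreasing k`, so only the comparisons
  -- with the new head have to be supplied.
  beginsDecreasing-∷⁺ : ∀ {k n p} {w : Vec ℕ n} ((k≤n , _) : BeginsWith (decreasing k) w) →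
    (∀ i → lookup (truncate k≤n w) i < p) → BeginsWith (decreasing (suc k)) (p ∷ᵛ w)
  beginsDecreasing-∷⁺ {k} {n} {p} {w} (k≤n , iso) w<p = s≤s k≤n , iso′
    where
    iso′ : OrderIsomorphic (p ∷ᵛ truncate k≤n w) (decreasing (suc k))
    iso′ zero zero = neither (<-irrefl refl) (<-irrefl refl)
    iso′ zero (suc j) = neither (<-asym (w<p j)) (≤⇒≯ (m≤n⇒m≤1+n (lookup-decreasing-≤ k j)))
    iso′ (suc i) zero = both (w<p i) (s≤s (lookup-decreasing-≤ k i))
    iso′ (suc i) (suc j) = iso i j

  beginsDecreasing-tail : ∀ {k n p} {w : Vec ℕ n} →
    BeginsWith (decreasing (suc k)) (p ∷ᵛ w) → BeginsWith (decreasing k) w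
  beginsDecreasing-tail (s≤s k≤n , iso) = k≤n , λ i j → iso (suc i) (suc j)

  beginsDecreasing-head : ∀ {k n p} {w : Vec ℕ n} ((k≤n , _) : BeginsWith (decreasing (suc k)) (p ∷ᵛ w)) →
    ∀ i → lookup (truncate (s≤s⁻¹ k≤n) w) i < p
  beginsDecreasing-head {k} (s≤s k≤n , iso) i =
    Equivalence.from (iso (suc i) zero) (s≤s (lookup-decreasing-≤ k i))

  beginsDecreasing-1 : ∀ {n p} {w : Vec ℕ n} → BeginsWith (decreasing 1) (p ∷ᵛ w)
  beginsDecreasing-1 {w = w} = beginsDecreasing-∷⁺ {w = w} (z≤n , λ ()) λ ()

  lookup-truncate : ∀ {P : ℕ → Set} {k n} (k≤n : k ≤ n) {w : Vec ℕ n} → VecAll.All P w → ∀ i → P (lookup (truncate k≤n w) i)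
  lookup-truncate (s≤s k≤n) (pb VecAll.∷ pw) zero = pb
  lookup-truncate (s≤s k≤n) (pb VecAll.∷ pw) (suc i) = lookup-truncate k≤n pw i

  -- `k` descents link `k` + 1 letters, hence the prefix length `suc k` once `p` is included.
  continues⁻ : ∀ k p {n} (w : Vec ℕ n) →
    Continues k p w → Avoids12-3 (p ∷ᵛ w) × BeginsWith (decreasing (suc k)) (p ∷ᵛ w)
  continues⁻ zero p []ᵛ _ = avoids-[-] p , beginsDecreasing-1 {w = []ᵛ}
  continues⁻ zero p (b ∷ᵛ w) (w≤b , c) =
    avoids-∷⁺ w≤b (proj₁ (continues⁻ zero b w c)) , beginsDecreasing-1 {w = b ∷ᵛ w}
  continues⁻ (suc k) p (b ∷ᵛ w) (b<p , c) with continues⁻ k b w c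
  ... | av , bw@(s≤s k≤n , _) =
    -- The letter `b` exceeds the rest of its decreasing prefix, so `b < p` places the whole prefix
    -- below `p`.
    avoids-∷⁺ (contradiction b<p ∘ <-asym) av , beginsDecreasing-∷⁺ {w = b ∷ᵛ w} bw λ where
      zero    → b<p
      (suc i) → <-trans (beginsDecreasing-head {w = w} bw i) b<p

  continues⁺ : ∀ k p {n} (w : Vec ℕ n) →
    Avoids12-3 (p ∷ᵛ w) × BeginsWith (decreasing (suc k)) (p ∷ᵛ w) → Continues k p w
  continues⁺ zero p []ᵛ _ = Unit.tt
  continues⁺ (suc k) p []ᵛ (_ , s≤s () , _)
  continues⁺ zero p (b ∷ᵛ w) (av , _) =
    avoids-∷⁻ av , continues⁺ zero b w (avoids-tail av , beginsDecreasing-1 {w = w})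
  continues⁺ (suc k) p (b ∷ᵛ w) (av , bw@(s≤s (s≤s _) , _)) =
    beginsDecreasing-head {w = b ∷ᵛ w} bw zero , continues⁺ k b w (avoids-tail av , beginsDecreasing-tail {w = b ∷ᵛ w} bw)

  words-all : ∀ {P : A → Set} {R} → All P R → ∀ n → All (VecAll.All P) (words R n)
  words-all _ zero = VecAll.[] ∷ []
  words-all {P = P} {R} pR (suc n) = go pR
    where
    go : ∀ {R′} → All P R′ → All (VecAll.All P) (cartesianProductWith _∷ᵛ_ R′ (words R n))
    go [] = []
    go (pa ∷ pR′) = All.++⁺ (All.map⁺ (All.map (pa VecAll.∷_) (words-all pR n))) (go pR′)

  N12-3≡extensions : ∀ k n → N12-3 (decreasing k) n ≡ extensions n k n
  N12-3≡extensions k n = begin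
    N12-3 (decreasing k) n
      ≡⟨ length-filter good? (permutations n) ⟩
    ∑ (permutations n) (𝟙 ∘ good?)
      ≡⟨ ∑-filter unique? (words R n) (𝟙 ∘ good?) ⟩
    ∑ (words R n) (λ w → 𝟙 (unique? w) * 𝟙 (good? w))
      ≡⟨ ∑-cong-local (All.map (λ {w} w<1+n → cong (𝟙 (unique? w) *_)
           (𝟙-cong (prepend w w<1+n) (drop w) (good? w) (continues? k (suc n) w)))
           (words-all R<1+n n)) ⟩
    arrangements n k (suc n) R
      ≡⟨ arrangements≡extensions n k (suc n) sortedR ∣R∣ (All.map >⇒≢ R<1+n) ⟩
    extensions n k (below (suc n) R)
      ≡⟨ cong (extensions n k) (trans (below-all R<1+n) ∣R∣) ⟩
    extensions n k n ∎
    where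
    R = map suc (upTo n)
    good? : Decidable (λ (w : Vec ℕ n) → Avoids12-3 w × BeginsWith (decreasing k) w)
    good? w = avoids12-3? w ×-dec beginsWith? (decreasing k) w
    R<1+n : All (_< suc n) R
    R<1+n = All.map⁺ (All.applyUpTo⁺₁ id n s≤s)
    sortedR : Sorted R
    sortedR = AllPairs.map⁺ (AllPairs.applyUpTo⁺₁ id n λ i<j _ → s<s i<j)
    ∣R∣ : length R ≡ n
    ∣R∣ = trans (length-map suc (upTo n)) (length-upTo n)
    prepend : ∀ w → VecAll.All (_< suc n) w →
      Avoids12-3 w × BeginsWith (decreasing k) w → Continues k (suc n) w
    prepend w w<1+n (av , bw@(k≤n , _)) = continues⁺ k (suc n) w
      (avoids-descent⁺ w<1+n av , beginsDecreasing-∷⁺ {w = w} bw (lookup-truncate k≤n w<1+n))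
    drop : ∀ w → Continues k (suc n) w → Avoids12-3 w × BeginsWith (decreasing k) w
    drop w c = let av , bw = continues⁻ k (suc n) w c in avoids-tail av , beginsDecreasing-tail {w = w} bw

  -- The closed formula over the integers

  open import Data.Integer using (+_)

  -- Moves the subtractions outside, so that what is left under each sum is an expression in natural
  -- numbers.
  ∑ℤ-linear : ∀ (xs : List ℕ) k (a b c x : ℕ → ℕ) →
    foldr ℤ._+_ 0ℤ (map (λ j → (+ a j ℤ.- + k ℤ.* + b j ℤ.- + c j) ℤ.* + x j) xs)
    ≡ + ∑ xs (λ j → a j * x j) ℤ.- + k ℤ.* + ∑ xs (λ j → b j * x j) ℤ.- + ∑ xs (λ j → c j * x j)
  ∑ℤ-linear [] k a b c x = zeros (+ k)
    where
    zeros : ∀ k → 0ℤ ≡ 0ℤ ℤ.- k ℤ.* 0ℤ ℤ.- 0ℤ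
    zeros = ℤSolver.solve-∀
  ∑ℤ-linear (j ∷ js) k a b c x = begin
    (+ a j ℤ.- + k ℤ.* + b j ℤ.- + c j) ℤ.* + x j
      ℤ.+ foldr ℤ._+_ 0ℤ (map (λ j → (+ a j ℤ.- + k ℤ.* + b j ℤ.- + c j) ℤ.* + x j) js)
      ≡⟨ cong (ℤ._+_ ((+ a j ℤ.- + k ℤ.* + b j ℤ.- + c j) ℤ.* + x j)) (∑ℤ-linear js k a b c x) ⟩
    (+ a j ℤ.- + k ℤ.* + b j ℤ.- + c j) ℤ.* + x j ℤ.+ (u ℤ.- + k ℤ.* v ℤ.- w)
      ≡⟨ collect (+ k) (+ a j) (+ b j) (+ c j) (+ x j) u v w ⟩
    (+ a j ℤ.* + x j ℤ.+ u) ℤ.- + k ℤ.* (+ b j ℤ.* + x j ℤ.+ v) ℤ.- (+ c j ℤ.* + x j ℤ.+ w)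
      ≡⟨ cong₂ ℤ._-_ (cong₂ (λ p q → (p ℤ.+ u) ℤ.- + k ℤ.* (q ℤ.+ v)) (ℤ.pos-* (a j) (x j)) (ℤ.pos-* (b j) (x j)))
                     (cong (ℤ._+ w) (ℤ.pos-* (c j) (x j))) ⟨
    (+ (a j * x j) ℤ.+ u) ℤ.- + k ℤ.* (+ (b j * x j) ℤ.+ v) ℤ.- (+ (c j * x j) ℤ.+ w) ∎
    where
    u = + ∑ js (λ j → a j * x j)
    v = + ∑ js (λ j → b j * x j)
    w = + ∑ js (λ j → c j * x j)
    collect : ∀ k a b c x u v w →
      (a ℤ.- k ℤ.* b ℤ.- c) ℤ.* x ℤ.+ (u ℤ.- k ℤ.* v ℤ.- w)
      ≡ (a ℤ.* x ℤ.+ u) ℤ.- k ℤ.* (b ℤ.* x ℤ.+ v) ℤ.- (c ℤ.* x ℤ.+ w)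
    collect = ℤSolver.solve-∀

  nC-complement : ∀ e c {d j} → j ≤ d → (e + (c + d)) C (e + j) ≡ (e + (c + d)) C (c + (d ∸ j))
  nC-complement e c {d} {j} j≤d = begin
    (e + (c + d)) C (e + j)                     ≡⟨ nCk≡nC[n∸k] (+-monoʳ-≤ e (≤-trans j≤d (m≤n+m d c))) ⟩
    (e + (c + d)) C (e + (c + d) ∸ (e + j))     ≡⟨ cong ((e + (c + d)) C_) ([m+n]∸[m+o]≡n∸o e (c + d) j) ⟩
    (e + (c + d)) C (c + d ∸ j)                 ≡⟨ cong ((e + (c + d)) C_) (+-∸-assoc c j≤d) ⟩
    (e + (c + d)) C (c + (d ∸ j))               ∎

  -- Substitute m = d - j and use the symmetry of binomial coefficients. The sum over j < d lacks m
  -- = 0, whose term is the added C(e+c+d, c), since B_0 = 1. The three sums of the formula are the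
  -- cases (e, c) = (0, 0), (0, 1) and (k, 1).
  ∑-nC-reverse : ∀ e c d →
    ∑ (upTo d) (λ j → ((e + (c + d)) C (e + j)) * bellNumber (d ∸ j)) + (e + (c + d)) C c
    ≡ ∑ (upTo (suc d)) λ m → ((e + (c + d)) C (c + m)) * bellNumber m
  ∑-nC-reverse e c d = begin
    ∑ (upTo d) f + n C c           ≡⟨ cong (_+_ (∑ (upTo d) f)) last ⟨
    ∑ (upTo d) f + f d             ≡⟨ ∑-upTo-sucʳ d f ⟨
    ∑ (upTo (suc d)) f             ≡⟨ ∑-cong-local (All.applyUpTo⁺₁ id (suc d) λ {j} j≤d →
                                        cong (_* bellNumber (d ∸ j)) (nC-complement e c (s≤s⁻¹ j≤d))) ⟩
    ∑ (upTo (suc d)) (λ j → g (d ∸ j)) ≡⟨ ∑-upTo-reverse d g ⟩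
    ∑ (upTo (suc d)) g             ∎
    where
    n = e + (c + d)
    f g : ℕ → ℕ
    f j = (n C (e + j)) * bellNumber (d ∸ j)
    g m = (n C (c + m)) * bellNumber m
    last : f d ≡ n C c
    last = begin
      (n C (e + d)) * bellNumber (d ∸ d)   ≡⟨ cong₂ (λ i b → i * bellNumber b) (nC-complement e c {d} ≤-refl) (n∸n≡0 d) ⟩
      (n C (c + (d ∸ d))) * 1              ≡⟨ *-identityʳ _ ⟩
      n C (c + (d ∸ d))                    ≡⟨ cong (λ i → n C (c + i)) (n∸n≡0 d) ⟩
      n C (c + 0)                          ≡⟨ cong (n C_) (+-identityʳ c) ⟩
      n C c                                ∎

  extensions-formula : ∀ k d → + extensions (k + suc d) k (k + suc d)
    ≡ + (k + 1) ℤ.* + bellNumber (suc d)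
      ℤ.+ ∑[ j < d ]
        ((+ ((k + suc d) C (k + j)) ℤ.- + k ℤ.* + (d C j) ℤ.- + (suc d C j)) ℤ.* + bellNumber (d ∸ j))
  extensions-formula k d = begin
    + e
      -- The missing terms of `a` and `c` are `k + suc d` and `suc d`. Adding and subtracting the
      -- completed `c` makes the subtraction-free `extensions-closed` applicable.
      ≡⟨ isolate (+ e) (+ c) (+ suc d) ⟩
    + (e + (c + suc d)) ℤ.- (+ c ℤ.+ + suc d)
      ≡⟨ cong (λ i → + i ℤ.- (+ c ℤ.+ + suc d)) closed ⟩
    + (b + 1 + (a + (k + suc d))) ℤ.- (+ c ℤ.+ + suc d)
      ≡⟨ distribute (+ a) (+ b) (+ c) (+ suc d) (+ k) ⟩
    + (k + 1) ℤ.* + (b + 1) ℤ.+ (+ a ℤ.- + k ℤ.* + b ℤ.- + c)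
      ≡⟨ cong₂ (λ i z → + (k + 1) ℤ.* + i ℤ.+ z) bell-step
           (sym (∑ℤ-linear (upTo d) k _ _ _ (λ j → bellNumber (d ∸ j)))) ⟩
    _ ∎
    where
    e a b c : ℕ
    e = extensions (k + suc d) k (k + suc d)
    a = ∑ (upTo d) λ j → ((k + suc d) C (k + j)) * bellNumber (d ∸ j)
    b = ∑ (upTo d) λ j → (d C j) * bellNumber (d ∸ j)
    c = ∑ (upTo d) λ j → (suc d C j) * bellNumber (d ∸ j)
    bell-step : b + 1 ≡ bellNumber (suc d)
    bell-step = begin
      b + 1             ≡⟨ cong (_+_ b) (nC0≡1 d) ⟨
      b + d C 0         ≡⟨ ∑-nC-reverse 0 0 d ⟩
      ∑ (upTo (suc d)) (λ m → (d C m) * bellNumber m)  ≡⟨ ∑-cong (upTo (suc d)) (λ m → cong (λ i → (d C m) * bellNumber i) (+-identityʳ m)) ⟨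
      binomialSum d d 0 ≡⟨ bellNumber-suc d ⟨
      bellNumber (suc d) ∎
    closed : e + (c + suc d) ≡ b + 1 + (a + (k + suc d))
    closed = begin
      e + (c + suc d)                 ≡⟨ cong (λ i → e + (c + i)) (nC1≡n (suc d)) ⟨
      e + (c + suc d C 1)             ≡⟨ cong (_+_ e) (∑-nC-reverse 0 1 d) ⟩
      e + ∑ (upTo (suc d)) (λ m → (suc d C suc m) * bellNumber m)
        ≡⟨ extensions-closed k d ⟩
      bellNumber (suc d) + ∑ (upTo (suc d)) (λ m → ((k + suc d) C suc m) * bellNumber m)
        ≡⟨ cong₂ _+_ bell-step (∑-nC-reverse k 1 d) ⟨
      b + 1 + (a + (k + suc d) C 1)   ≡⟨ cong (λ i → b + 1 + (a + i)) (nC1≡n (k + suc d)) ⟩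
      b + 1 + (a + (k + suc d))       ∎
    isolate : ∀ e c s → e ≡ e ℤ.+ (c ℤ.+ s) ℤ.- (c ℤ.+ s)
    isolate = ℤSolver.solve-∀
    distribute : ∀ a b c s k →
      (b ℤ.+ 1ℤ ℤ.+ (a ℤ.+ (k ℤ.+ s))) ℤ.- (c ℤ.+ s)
      ≡ (k ℤ.+ 1ℤ) ℤ.* (b ℤ.+ 1ℤ) ℤ.+ (a ℤ.- k ℤ.* b ℤ.- c)
    distribute = ℤSolver.solve-∀

  N12-3-formula : ∀ k d → + N12-3 (decreasing k) (k + suc d)
    ≡ + (k + 1) ℤ.* + bell (suc d)
      ℤ.+ ∑[ j < d ]
        ((+ ((k + suc d) C (k + j)) ℤ.- + k ℤ.* + (d C j) ℤ.- + (suc d C j)) ℤ.* + bell (d ∸ j))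
  N12-3-formula k d = begin
    + N12-3 (decreasing k) (k + suc d)
      ≡⟨ cong +_ (N12-3≡extensions k (k + suc d)) ⟩
    + extensions (k + suc d) k (k + suc d)
      ≡⟨ extensions-formula k d ⟩
    + (k + 1) ℤ.* + bellNumber (suc d) ℤ.+ ∑[ j < d ] (coefficient j ℤ.* + bellNumber (d ∸ j))
      ≡⟨ cong₂ (λ b s → + (k + 1) ℤ.* + b ℤ.+ s) (bell≡bellNumber (suc d))
           (cong (foldr ℤ._+_ 0ℤ) (map-cong (λ j → cong (λ b → coefficient j ℤ.* + b) (bell≡bellNumber (d ∸ j))) (upTo d))) ⟨
    + (k + 1) ℤ.* + bell (suc d) ℤ.+ ∑[ j < d ] (coefficient j ℤ.* + bell (d ∸ j)) ∎
    where
    coefficient : ℕ → ℤ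
    coefficient j = + ((k + suc d) C (k + j)) ℤ.- + k ℤ.* + (d C j) ℤ.- + (suc d C j)

open import Data.Nat using (ℕ; _≤_; _∸_) renaming (_+_ to _+ℕ_)
open import Data.Nat.Combinatorics using (_C_)
open import Data.Integer using (+_; _+_; _-_; _*_)
open import Data.Product using (_×_)
open import Relation.Binary.PropositionalEquality using (_≡_)
open import Data.Nat using (suc; s≤s)
open import Data.Nat.Properties using (m≤n⇒∃[o]m+o≡n; m+n∸m≡n; +-assoc)
open import Data.Product using (_,_)
open import Relation.Binary.PropositionalEquality using (refl; sym; trans; subst)

proposition9 : ∀ (k : ℕ) → 1 ≤ k →
    (∀ (n : ℕ) → k +ℕ 1 ≤ n →
    + N12-3 (decreasing k) n
    ≡ + (k +ℕ 1) * + bell (n ∸ k)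
    + ∑[ j < n ∸ k ∸ 1 ]
    ((+ (n C (k +ℕ j)) - + k * + ((n ∸ k ∸ 1) C j) - + ((n ∸ k) C j))
    * + bell (n ∸ k ∸ 1 ∸ j)))
    × N12-3 (decreasing k) k ≡ 1
    × (∀ (n : ℕ) → 1 ≤ n → n ≤ k ∸ 1 → N12-3 (decreasing k) n ≡ 0)
proposition9 k 1≤k = formula , trans (N12-3≡extensions k k) (extensions-all k) , short k 1≤k
  where
  Formula : ℕ → Set
  Formula n = + N12-3 (decreasing k) n
    ≡ + (k +ℕ 1) * + bell (n ∸ k)
      + ∑[ j < n ∸ k ∸ 1 ]
          ((+ (n C (k +ℕ j)) - + k * + ((n ∸ k ∸ 1) C j) - + ((n ∸ k) C j))
            * + bell (n ∸ k ∸ 1 ∸ j))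
  formula : ∀ n → k +ℕ 1 ≤ n → Formula n
  formula n k<n with d , k+1+d≡n ← m≤n⇒∃[o]m+o≡n k<n =
    subst Formula (trans (sym (+-assoc k 1 d)) k+1+d≡n) (shifted d)
    where
    shifted : ∀ d → Formula (k +ℕ suc d)
    -- For n = k + (d + 1) the truncated differences `n ∸ k` and `n ∸ k ∸ 1` become `suc d` and `d`.
    shifted d rewrite m+n∸m≡n k (suc d) = N12-3-formula k d
  short : ∀ k → 1 ≤ k → ∀ n → 1 ≤ n → n ≤ k ∸ 1 → N12-3 (decreasing k) n ≡ 0
  -- All `n` letters lie below the virtual one, but they are too few for `suc k` descents.
  short (suc k) _ n _ n≤k =
    trans (N12-3≡extensions (suc k) n) (extensions-below n (suc k) n (s≤s n≤k))
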